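{- Let $n \geq 3$ be a positive integer, and let $A, B$ be symmetric $n \times n$ matrices over a field $K$ of characteristic zero. Let $(f_A, f_B)$ be the corresponding pair of $n$-ary quadratic forms. Then the pair $(A,B)$ can be simultaneously diagonalized over the splitting field $L$ of the binary form $$F_{(A,B)}(x,y) = \det(Ax - By) = \prod_{j=1}^n (s_j x - t_j y).$$ Moreover, up to permutation of columns there is a unique matrix $U$ defined over $L$ such that $(U^t A U, U^t B U)$ is a pair of diagonal matrices. The linear forms $U\mathbf{x}$, up to a scalar factor, are determined by the adjugates of the matrices $t_i A - s_i B$, $1 \leq i \leq n$.
   Context: For a symmetric matrix $M$, the associated quadratic form is $f_M(\mathbf{x}) = \mathbf{x}^t M\mathbf{x}$. The numbers $s_j, t_j$ are those appearing in the factorization of $F_{(A,B)}$ into linear forms displayed in the claim.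
   Formalization: The binary form is assumed to have nonzero discriminant (the claim fails for repeated roots); U is unique up to permutation and nonzero scaling of columns; the linear forms are those given by the columns of U, i.e. the entries of U^t x. -}

module Defs where

open import Level using (Level; _⊔_)
open import Algebra.Apartness.Bundles using (HeytingCommutativeRing; HeytingField)
open import Algebra.Bundles using (CommutativeRing)
open import Algebra.Bundles.Raw using (RawRing)
import Algebra.Definitions
import Algebra.Definitions.RawSemiring
open import Algebra.Morphism.Structures using (module RingMorphisms)
open import Data.Bool.Base using (if_then_else_)
open import Data.Fin.Base using (Fin; zero; suc; toℕ; punchIn)
open import Data.Fin.Permutation using (Permutation′; _⟨$⟩ʳ_)
import Data.Fin.Properties as Fin
open import Data.List.Base as List using (List; []; _∷_)
open import Data.Nat.Base as ℕ using (ℕ; zero; suc)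
open import Data.Product.Base using (Σ-syntax; ∃-syntax; _×_)
open import Data.Vec.Functional using (Vector; transpose)
open import Relation.Binary.PropositionalEquality.Core using (_≢_)
open import Relation.Nullary.Decidable.Core using (does)
open import Relation.Nullary.Negation.Core using (¬_)

private
  variable
    a ℓ a₁ ℓ₁ r₁ a₂ ℓ₂ r₂ : Level

Matrix : Set a → ℕ → Set a
Matrix C n = Vector (Vector C n) n

mapMatrix : {C : Set a₁} {D : Set a₂} {n : ℕ} → (C → D) → Matrix C n → Matrix D n
mapMatrix f M i j = f (M i j)

module MatrixOps (R : RawRing a ℓ) where
  open RawRing R
  open Algebra.Definitions.RawSemiring rawSemiring using (sum; _^_)

  Mat : ℕ → Set a
  Mat = Matrix Carrier

  infix 4 _≋_
  infixl 7 _·_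

  _≋_ : {n : ℕ} → Mat n → Mat n → Set ℓ
  M ≋ N = ∀ i j → M i j ≈ N i j

  _·_ : {n : ℕ} → Mat n → Mat n → Mat n
  (M · N) i j = sum (λ k → M i k * N k j)

  identity : {n : ℕ} → Mat n
  identity i j = if does (i Fin.≟ j) then 1# else 0#

  Invertible : {n : ℕ} → Mat n → Set (a ⊔ ℓ)
  Invertible M = Algebra.Definitions.Invertible _≋_ identity _·_ M

  IsSymmetric : {n : ℕ} → Mat n → Set ℓ
  IsSymmetric M = M ≋ transpose M

  IsDiagonal : {n : ℕ} → Mat n → Set ℓ
  IsDiagonal M = ∀ i j → i ≢ j → M i j ≈ 0#

  sign : ℕ → Carrier
  sign k = (- 1#) ^ k

  minor : {n : ℕ} → Mat (suc n) → Fin (suc n) → Fin (suc n) → Mat n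
  minor M i j p q = M (punchIn i p) (punchIn j q)

  -- Laplace expansion along the first row.
  det : {n : ℕ} → Mat n → Carrier
  det {zero}  M = 1#
  det {suc n} M = sum (λ j → sign (toℕ j) * (M zero j * det (minor M zero j)))

  adjugate : {n : ℕ} → Mat n → Mat n
  adjugate {suc n} M i j = sign (toℕ i ℕ.+ toℕ j) * det (minor M j i)

  linearForm : {n : ℕ} → Vector Carrier n → Vector Carrier n → Carrier
  linearForm u x = sum (λ i → u i * x i)

  quadraticForm : {n : ℕ} → Mat n → Vector Carrier n → Carrier
  quadraticForm M x = sum (λ i → sum (λ j → x i * (M i j * x j)))

-- Univariate polynomials R[X] as lists of coefficients, constant term first.
-- Trailing zeros are allowed, so equality is equality of all coefficients.
module _ (R : RawRing a ℓ) where
  open RawRing R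

  coeff : List Carrier → ℕ → Carrier
  coeff []      k       = 0#
  coeff (c ∷ p) zero    = c
  coeff (c ∷ p) (suc k) = coeff p k

  addPoly : List Carrier → List Carrier → List Carrier
  addPoly []      q       = q
  addPoly (c ∷ p) []      = c ∷ p
  addPoly (c ∷ p) (d ∷ q) = (c + d) ∷ addPoly p q

  mulPoly : List Carrier → List Carrier → List Carrier
  mulPoly []      q = []
  mulPoly (c ∷ p) q = addPoly (List.map (c *_) q) (0# ∷ mulPoly p q)

  polynomialRing : RawRing a ℓ
  polynomialRing = record
    { Carrier = List Carrier
    ; _≈_     = λ p q → ∀ k → coeff p k ≈ coeff q k
    ; _+_     = addPoly
    ; _*_     = mulPoly
    ; -_      = List.map (-_)
    ; 0#      = []
    ; 1#      = 1# ∷ []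
    }

-- R[x,y], realised as R[x][y].
polynomialRing₂ : RawRing a ℓ → RawRing a ℓ
polynomialRing₂ R = polynomialRing (polynomialRing R)

mapPoly₂ : {C : Set a₁} {D : Set a₂} → (C → D) → List (List C) → List (List D)
mapPoly₂ f = List.map (List.map f)

module BinaryForms (R : RawRing a ℓ) where
  open RawRing R using (Carrier; 0#; 1#)
  open RawRing (polynomialRing₂ R) using (_+_; _*_; -_) renaming (Carrier to Poly₂)
  open MatrixOps (polynomialRing₂ R) using (det)

  varX varY : Poly₂
  varX = (0# ∷ 1# ∷ []) ∷ []
  varY = [] ∷ (1# ∷ []) ∷ []

  constant : Carrier → Poly₂
  constant c = (c ∷ []) ∷ []

  -- s x − t y
  binaryLinear : Carrier → Carrier → Poly₂
  binaryLinear s t = (constant s * varX) + (- (constant t * varY))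

  -- F_{(A,B)}(x,y) = det (A x − B y)
  pencilForm : {n : ℕ} → Matrix Carrier n → Matrix Carrier n → Poly₂
  pencilForm A B = det (λ i j → binaryLinear (A i j) (B i j))

-- The discriminant ∏_{i<j} (sᵢ tⱼ − sⱼ tᵢ)² of the binary form ∏ⱼ (sⱼ x − tⱼ y).
module _ (R : RawRing a ℓ) where
  open RawRing R
  open Algebra.Definitions.RawSemiring rawSemiring using (product; _^_)

  discriminant : {n : ℕ} → Vector Carrier n → Vector Carrier n → Carrier
  discriminant s t = product λ i → product λ j →
    if does (i Fin.<? j) then ((s i * t j) + (- (s j * t i))) ^ 2 else 1#

-- Fields are Heyting fields: _#_ is the constructive form of "distinct", and
-- every classical field is one with x # y taken to be ¬ (x ≈ y).
fieldRing : HeytingField a₁ ℓ₁ r₁ → RawRing a₁ ℓ₁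
fieldRing K = CommutativeRing.rawRing
  (HeytingCommutativeRing.commutativeRing (HeytingField.heytingCommutativeRing K))

CharacteristicZero : HeytingField a₁ ℓ₁ r₁ → Set ℓ₁
CharacteristicZero K = ∀ m → ¬ ((suc m ×ₙ 1#) ≈ 0#)
  where
  open HeytingField K using (_≈_; 0#; 1#)
  open Algebra.Definitions.RawSemiring (RawRing.rawSemiring (fieldRing K))
    renaming (_×_ to _×ₙ_) using ()

module _ (K : HeytingField a₁ ℓ₁ r₁) (L : HeytingField a₂ ℓ₂ r₂) where
  private
    module K = HeytingField K
    module L = HeytingField L
  open L using (_≈_; _#_; _+_; _*_; -_; 0#; 1#)

  -- The subfield of L generated by the image of K and the roots of
  -- ∏ⱼ (sⱼ x − tⱼ y).  The root is the point (x : y) = (tⱼ : sⱼ) of the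
  -- projective line; adjoining it means adjoining its affine coordinates
  -- tⱼ / sⱼ and sⱼ / tⱼ, so far as they exist.
  data GeneratedSubfield (ι : K.Carrier → L.Carrier) {n : ℕ} (s t : Vector L.Carrier n)
       : L.Carrier → Set (a₁ ⊔ a₂ ⊔ ℓ₂ ⊔ r₂) where
    base     : ∀ k → GeneratedSubfield ι s t (ι k)
    root     : ∀ j {z} → s j # 0# → s j * z ≈ t j → GeneratedSubfield ι s t z
    root⁻¹   : ∀ j {z} → t j # 0# → t j * z ≈ s j → GeneratedSubfield ι s t z
    add      : ∀ {y z} → GeneratedSubfield ι s t y → GeneratedSubfield ι s t z →
               GeneratedSubfield ι s t (y + z)
    mul      : ∀ {y z} → GeneratedSubfield ι s t y → GeneratedSubfield ι s t z →
               GeneratedSubfield ι s t (y * z)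
    neg      : ∀ {z} → GeneratedSubfield ι s t z → GeneratedSubfield ι s t (- z)
    inv      : ∀ {y z} → y * z ≈ 1# → GeneratedSubfield ι s t y → GeneratedSubfield ι s t z
    respects : ∀ {y z} → y ≈ z → GeneratedSubfield ι s t y → GeneratedSubfield ι s t z

  -- L, with the embedding ι, is a splitting field over K of F ∈ K[x,y], in
  -- which F factors as ∏ⱼ (sⱼ x − tⱼ y).  ι is automatically injective.
  record IsSplittingField (ι : K.Carrier → L.Carrier)
                          (F : RawRing.Carrier (polynomialRing₂ (fieldRing K)))
                          {n : ℕ} (s t : Vector L.Carrier n)
         : Set (a₁ ⊔ ℓ₁ ⊔ a₂ ⊔ ℓ₂ ⊔ r₂) where
    private
      module L[x,y] = RawRing (polynomialRing₂ (fieldRing L))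
    open RingMorphisms (fieldRing K) (fieldRing L) using (IsRingHomomorphism)
    open BinaryForms (fieldRing L) using (binaryLinear)
    open Algebra.Definitions.RawSemiring L[x,y].rawSemiring using (product)
    field
      isRingHomomorphism : IsRingHomomorphism ι
      factorization      : mapPoly₂ ι F L[x,y].≈ product (λ j → binaryLinear (s j) (t j))
      generated          : ∀ z → GeneratedSubfield ι s t z

module Diagonalization (L : HeytingField a ℓ r₁) where
  open HeytingField L public using (Carrier; _≈_; _#_; _+_; _*_; -_; 0#; 1#)
  open MatrixOps (fieldRing L) public

  SimultaneouslyDiagonalizes : {n : ℕ} → Mat n → Mat n → Mat n → Set (a ⊔ ℓ)
  SimultaneouslyDiagonalizes U A B =
    Invertible U ×
    IsDiagonal (transpose U · A · U) ×
    IsDiagonal (transpose U · B · U)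

  -- Equality up to a permutation of the columns and nonzero scalars on them;
  -- scaling a column always preserves simultaneous diagonalization.
  SameColumns : {n : ℕ} → Mat n → Mat n → Set (a ⊔ ℓ ⊔ r₁)
  SameColumns {n} V U =
    Σ[ σ ∈ Permutation′ n ] Σ[ c ∈ Vector Carrier n ]
      (∀ k → c k # 0#) × (∀ i k → V i k ≈ c k * U i (σ ⟨$⟩ʳ k))

  -- t A − s B
  pencilAt : {n : ℕ} → Mat n → Mat n → Carrier → Carrier → Mat n
  pencilAt A B s t i j = (t * A i j) + (- (s * B i j))

  -- The quadratic form Q is, up to a nonzero scalar, the square of the linear
  -- form with coefficients u; this determines the latter up to a scalar.
  IsSquareOf : {n : ℕ} → Mat n → Vector Carrier n → Set (a ⊔ ℓ ⊔ r₁)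
  IsSquareOf Q u =
    ∃[ c ] (c # 0#) ×
      (∀ x → quadraticForm Q x ≈ c * (linearForm u x * linearForm u x))

module Submission where

-- Write Mᵢ = tᵢ A − sᵢ B and Pᵢ = adj Mᵢ.  Reading det (Ax − By) = ∏ⱼ (sⱼ x − tⱼ y)
-- over the dual numbers at (tᵢ + ε tⱼ , sᵢ + ε sⱼ) gives det Mᵢ = 0 and, by Jacobi's
-- formula, tr (Pᵢ Mⱼ) ≠ 0 for j ≠ i.  Hence Pᵢ is a nonzero symmetric matrix of rank
-- one, some diagonal entry of it is nonzero, and the corresponding column uᵢ satisfies
-- Mᵢ uᵢ = 0 and uᵢ uᵢᵗ = c Pᵢ with c ≠ 0.  The relations tᵢ A uᵢ = sᵢ B uᵢ make the uᵢ
-- orthogonal for both A and B, so U = (u₁ … uₙ) diagonalizes the pair, and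
-- uᵢᵗ Mⱼ uᵢ = c tr (Pᵢ Mⱼ) ≠ 0 makes U invertible.  If V also diagonalizes the pair and
-- V = U C, then comparing Uᵗ A V and Uᵗ B V in two ways shows that two rows i ≠ j of C
-- cannot both be nonzero in one column, so C is monomial.
--
-- Fields are Heyting fields without decidable equality, so every "≠ 0" is an apartness.

open import Defs
open import Level using (Level; 0ℓ; _⊔_)
open import Algebra.Apartness.Bundles using (HeytingCommutativeRing; HeytingField)
import Algebra.Apartness.Properties.HeytingCommutativeRing
open import Algebra.Bundles using (CommutativeRing)
open import Algebra.Bundles.Raw using (RawRing)
import Algebra.Definitions.RawSemiring
import Algebra.Module.Construct.Idealization as Idealization
import Algebra.Module.Construct.TensorUnit as TensorUnit
import Algebra.Morphism.Construct.Composition as Composition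
open import Algebra.Morphism.Structures using (module RingMorphisms)
import Algebra.Properties.Monoid.Sum
import Algebra.Properties.Ring
import Algebra.Properties.Semiring.Mult
import Algebra.Properties.Semiring.Sum
import Algebra.Solver.CommutativeMonoid
import Algebra.Solver.Ring
import Algebra.Solver.Ring.AlmostCommutativeRing as ACR
open import Data.Bool.Base using (if_then_else_)
open import Data.Fin.Base using (Fin; zero; suc; toℕ; fromℕ<; punchIn; punchOut)
open import Data.Fin.Permutation using (permutation)
import Data.Fin.Properties as Fin
open import Data.List.Base as List using (List; []; _∷_)
open import Data.Maybe.Base using (Maybe; just; nothing)
open import Data.Nat.Base as ℕ using (ℕ; zero; suc; _≥_; s≤s)
import Data.Nat.Properties as ℕ
open import Data.Product.Base using (Σ-syntax; ∃-syntax; _×_; _,_; proj₁; proj₂)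
open import Data.Sum.Base using (_⊎_; inj₁; inj₂; [_,_]′)
open import Data.Vec.Functional using (Vector; transpose; updateAt)
open import Data.Vec.Functional.Properties using (updateAt-updates; updateAt-minimal)
open import Function.Base using (_∘_; const)
open import Function.Definitions using (Injective)
open import Relation.Binary.Bundles using (Setoid)
open import Relation.Binary.Definitions using (tri<; tri≈; tri>)
open import Relation.Binary.PropositionalEquality.Core as ≡ using (_≡_; _≢_)
import Relation.Binary.Reasoning.Setoid
open import Relation.Nullary.Decidable using (Dec; does; yes; no; dec-true; dec-false)
open import Relation.Nullary.Negation.Core using (contradiction)

-- The tangent direction (tⱼ , sⱼ) is chosen because the ε-part of Ax - By is then exactly Mⱼ and
-- that of the i-th linear factor is sᵢ tⱼ - tᵢ sⱼ, which the discriminant keeps away from zero.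
-- Without a test for zero there is no Gaussian elimination and no rank by cases. Rank one is
-- therefore a polynomial identity, a 2 × 2 minor of Pᵢ times an entry, and an index with an entry
-- apart from zero is obtained only by splitting a sum already known to be apart from zero. This is
-- the use of tr (Pᵢ Mⱼ): it carries both the pivots and the invertibility of U. Row i of a left
-- inverse of U comes from uᵢᵗ Mⱼ with j depending on i; an exchange of rows then makes the inverse
-- two-sided.

private
  variable
    a ℓ r a₁ ℓ₁ r₁ a₂ ℓ₂ r₂ : Level
    n : ℕ

-- Identities in commutative rings by integer arithmetic

module IntegerCoefficients (R : CommutativeRing a ℓ) where
  open CommutativeRing R
  open Algebra.Properties.Ring ring
    using (-0#≈0#; -‿distribˡ-*; -‿distribʳ-*; -‿involutive; -‿+-comm)
  open Algebra.Properties.Semiring.Mult semiring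
    using (×-homo-+; ×1-homo-*; ×-congˡ) renaming (_×_ to _×ₙ_)
  open Algebra.Solver.CommutativeMonoid +-commutativeMonoid
    using (_⊕_; _⊜_) renaming (solve to solve⁺)
  open Relation.Binary.Reasoning.Setoid setoid

  private
    -- The pair (m , n) stands for the integer m − n.
    Difference : RawRing 0ℓ 0ℓ
    Difference = record
      { Carrier = ℕ × ℕ
      ; _≈_     = _≡_
      ; _+_     = λ (m , n) (p , q) → m ℕ.+ p , n ℕ.+ q
      ; _*_     = λ (m , n) (p , q) → m ℕ.* p ℕ.+ n ℕ.* q , m ℕ.* q ℕ.+ n ℕ.* p
      ; -_      = λ (m , n) → n , m
      ; 0#      = 0 , 0
      ; 1#      = 1 , 0
      }

    ⟦_⟧ : ℕ × ℕ → Carrier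
    ⟦ m , n ⟧ = m ×ₙ 1# - n ×ₙ 1#

    +-shuffle : ∀ w x y z → (w + x) - (y + z) ≈ (w - y) + (x - z)
    +-shuffle w x y z = begin
      (w + x) - (y + z)       ≈⟨ +-congˡ (-‿+-comm y z) ⟨
      (w + x) + (- y + - z)   ≈⟨ solve⁺ 4 (λ w x y z → (w ⊕ x) ⊕ (y ⊕ z) ⊜ (w ⊕ y) ⊕ (x ⊕ z))
                                   refl w x (- y) (- z) ⟩
      (w - y) + (x - z)       ∎

    -x*-y≈x*y : ∀ x y → - x * - y ≈ x * y
    -x*-y≈x*y x y = begin
      - x * - y      ≈⟨ -‿distribˡ-* x (- y) ⟨
      - (x * - y)    ≈⟨ -‿cong (-‿distribʳ-* x y) ⟨
      - - (x * y)    ≈⟨ -‿involutive (x * y) ⟩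
      x * y          ∎

    *-shuffle : ∀ w x y z → (w * y + x * z) - (w * z + x * y) ≈ (w - x) * (y - z)
    *-shuffle w x y z = begin
      (w * y + x * z) - (w * z + x * y)
        ≈⟨ +-shuffle (w * y) (x * z) (w * z) (x * y) ⟩
      (w * y - w * z) + (x * z - x * y)
        ≈⟨ +-cong (+-congˡ (-‿distribʳ-* w z))
                  (trans (+-cong (sym (-x*-y≈x*y x z)) (-‿distribˡ-* x y)) (+-comm _ _)) ⟩
      (w * y + w * - z) + (- x * y + - x * - z)
        ≈⟨ +-cong (distribˡ w y (- z)) (distribˡ (- x) y (- z)) ⟨
      w * (y - z) + - x * (y - z)
        ≈⟨ distribʳ (y - z) w (- x) ⟨
      (w - x) * (y - z) ∎

    ×-homo-+-* : ∀ m n p q → (m ℕ.* p ℕ.+ n ℕ.* q) ×ₙ 1# ≈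
                 (m ×ₙ 1#) * (p ×ₙ 1#) + (n ×ₙ 1#) * (q ×ₙ 1#)
    ×-homo-+-* m n p q = trans (×-homo-+ 1# (m ℕ.* p) (n ℕ.* q))
      (+-cong (×1-homo-* m p) (×1-homo-* n q))

    -- Equality in `R` need not be decidable, so normal forms take their coefficients from formal
    -- differences of naturals, where cancellation can be detected.
    homomorphism : Difference ACR.-Raw-AlmostCommutative⟶ ACR.fromCommutativeRing R
    homomorphism = record
      { ⟦_⟧    = ⟦_⟧
      ; +-homo = λ (m , n) (p , q) → trans
          (+-cong (×-homo-+ 1# m p) (-‿cong (×-homo-+ 1# n q)))
          (+-shuffle _ _ _ _)
      ; *-homo = λ (m , n) (p , q) → trans
          (+-cong (×-homo-+-* m n p q) (-‿cong (×-homo-+-* m n q p)))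
          (*-shuffle _ _ _ _)
      ; -‿homo = λ (m , n) → begin
          n ×ₙ 1# - m ×ₙ 1#          ≈⟨ +-comm _ _ ⟩
          - (m ×ₙ 1#) + n ×ₙ 1#      ≈⟨ +-congˡ (-‿involutive _) ⟨
          - (m ×ₙ 1#) - - (n ×ₙ 1#)  ≈⟨ -‿+-comm _ _ ⟩
          - (m ×ₙ 1# - n ×ₙ 1#)      ∎
      ; 0-homo = -‿inverseʳ 0#
      ; 1-homo = trans (+-cong (+-identityʳ 1#) -0#≈0#) (+-identityʳ 1#)
      }

    -- Several pairs stand for one integer, so m - n = p - q is tested in ℕ as m + q = n + p.
    _coeff≟_ : ∀ c d → Maybe (⟦ c ⟧ ≈ ⟦ d ⟧)
    (m , n) coeff≟ (p , q) with m ℕ.+ q ℕ.≟ n ℕ.+ p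
    ... | no _ = nothing
    ... | yes m+q≡n+p = just (begin
      M - N                       ≈⟨ +-identityʳ _ ⟨
      (M - N) + 0#                ≈⟨ +-congˡ (-‿inverseʳ Q) ⟨
      (M - N) + (Q - Q)           ≈⟨ +-shuffle M Q N Q ⟨
      (M + Q) - (N + Q)           ≈⟨ +-congʳ (×-homo-+ 1# m q) ⟨
      (m ℕ.+ q) ×ₙ 1# - (N + Q)   ≈⟨ +-congʳ (×-congˡ m+q≡n+p) ⟩
      (n ℕ.+ p) ×ₙ 1# - (N + Q)   ≈⟨ +-congʳ (×-homo-+ 1# n p) ⟩
      (N + P) - (N + Q)           ≈⟨ +-shuffle N P N Q ⟩
      (N - N) + (P - Q)           ≈⟨ +-congʳ (-‿inverseʳ N) ⟩
      0# + (P - Q)                ≈⟨ +-identityˡ _ ⟩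
      P - Q                       ∎)
      where M = m ×ₙ 1#
            N = n ×ₙ 1#
            P = p ×ₙ 1#
            Q = q ×ₙ 1#

  open Algebra.Solver.Ring Difference (ACR.fromCommutativeRing R) homomorphism _coeff≟_ public
    using (solve; _:=_; _:+_; _:*_; _:-_; :-_)

-- Finite sums and ordered pairs of distinct columns

-- Swap a l b m : the ordered pairs of distinct columns (a , punchIn a l) and
-- (b , punchIn b m) are reverses of each other.
data Swap : {n : ℕ} → Fin (2 ℕ.+ n) → Fin (1 ℕ.+ n) → Fin (2 ℕ.+ n) → Fin (1 ℕ.+ n) → Set where
  first : {l : Fin (1 ℕ.+ n)} → Swap zero l (suc l) zero
  second : {l : Fin (1 ℕ.+ n)} → Swap (suc l) zero zero l
  both  : {a b : Fin (2 ℕ.+ n)} {l m : Fin (1 ℕ.+ n)} →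
          Swap a l b m → Swap (suc a) (suc l) (suc b) (suc m)

Swap-sym : {i j : Fin (2 ℕ.+ n)} {k l : Fin (1 ℕ.+ n)} → Swap i k j l → Swap j l i k
Swap-sym first    = second
Swap-sym second    = first
Swap-sym (both w) = both (Swap-sym w)

punchIn-Swap : {i j : Fin (2 ℕ.+ n)} {k l : Fin (1 ℕ.+ n)} → Swap i k j l → punchIn i k ≡ j
punchIn-Swap first    = ≡.refl
punchIn-Swap second    = ≡.refl
punchIn-Swap (both w) = ≡.cong suc (punchIn-Swap w)

-- Deleting two columns in either order leaves the same columns in the same order, so the two
-- second-order minors agree.
punchIn-punchIn-Swap : {i j : Fin (2 ℕ.+ n)} {k l : Fin (1 ℕ.+ n)} → Swap i k j l → ∀ q →
                       punchIn i (punchIn k q) ≡ punchIn j (punchIn l q)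
punchIn-punchIn-Swap first    q       = ≡.refl
punchIn-punchIn-Swap second    q       = ≡.refl
punchIn-punchIn-Swap (both w) zero    = ≡.refl
punchIn-punchIn-Swap (both w) (suc q) = ≡.cong suc (punchIn-punchIn-Swap w q)

module Sums (R : CommutativeRing a ℓ) where
  open CommutativeRing R hiding (zero)
  open Algebra.Properties.Semiring.Sum semiring
  open IntegerCoefficients R
  open Relation.Binary.Reasoning.Setoid setoid

  -- Opaque, so that unification does not unfold sums of known length.
  opaque
    ∑ : Vector Carrier n → Carrier
    ∑ = sum

    ∑-sum : (f : Vector Carrier n) → ∑ f ≈ sum f
    ∑-sum f = refl

    ∑-suc : (f : Vector Carrier (suc n)) → ∑ f ≈ f zero + ∑ (f ∘ suc)
    ∑-suc f = refl

    ∑-cong : {f g : Vector Carrier n} → (∀ i → f i ≈ g i) → ∑ f ≈ ∑ g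
    ∑-cong = sum-cong-≋

    ∑-zero : {f : Vector Carrier n} → (∀ i → f i ≈ 0#) → ∑ f ≈ 0#
    ∑-zero {n} f≈0 = trans (sum-cong-≋ f≈0) (sum-replicate-zero n)

    ∑-single : {f : Vector Carrier n} (k : Fin n) → (∀ i → i ≢ k → f i ≈ 0#) → ∑ f ≈ f k
    ∑-single {suc n} {f} k f≈0 = begin
      sum f                             ≈⟨ sum-remove {i = k} f ⟩
      f k + sum (λ i → f (punchIn k i)) ≈⟨ +-congˡ (∑-zero λ i → f≈0 _ (Fin.punchInᵢ≢i k i)) ⟩
      f k + 0#                          ≈⟨ +-identityʳ (f k) ⟩
      f k                               ∎

    ∑-+ : (f g : Vector Carrier n) → ∑ (λ i → f i + g i) ≈ ∑ f + ∑ g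
    ∑-+ = ∑-distrib-+

    ∑-exchange : {m n : ℕ} (f : Fin m → Fin n → Carrier) →
                 ∑ (λ i → ∑ (λ j → f i j)) ≈ ∑ (λ j → ∑ (λ i → f i j))
    ∑-exchange = ∑-comm

    *-∑ˡ : (x : Carrier) (f : Vector Carrier n) → x * ∑ f ≈ ∑ (λ i → x * f i)
    *-∑ˡ = *-distribˡ-sum

    *-∑ʳ : (x : Carrier) (f : Vector Carrier n) → ∑ f * x ≈ ∑ (λ i → f i * x)
    *-∑ʳ = *-distribʳ-sum

  *-*-∑ : ∀ x y (f : Vector Carrier n) → x * (y * ∑ f) ≈ ∑ (λ i → x * (y * f i))
  *-*-∑ x y f = trans (*-congˡ (*-∑ˡ y f)) (*-∑ˡ x _)

  -- Isolates the pairs that involve column zero. `Swap` exchanges their two families, and the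
  -- remaining double sum has the same shape with one column fewer, which drives the inductions
  -- below.
  double-∑-split : (f : Fin (suc (suc n)) → Fin (suc n) → Carrier) →
    ∑ (λ i → ∑ (f i)) ≈
    ∑ (f zero) + (∑ (λ i → f (suc i) zero) + ∑ (λ i → ∑ (λ l → f (suc i) (suc l))))
  double-∑-split f = begin
    ∑ (λ i → ∑ (f i))
      ≈⟨ ∑-suc _ ⟩
    ∑ (f zero) + ∑ (λ i → ∑ (f (suc i)))
      ≈⟨ +-congˡ (∑-cong λ i → ∑-suc (f (suc i))) ⟩
    ∑ (f zero) + ∑ (λ i → f (suc i) zero + ∑ (λ l → f (suc i) (suc l)))
      ≈⟨ +-congˡ (∑-+ _ _) ⟩
    ∑ (f zero) + (∑ (λ i → f (suc i) zero) + ∑ (λ i → ∑ (λ l → f (suc i) (suc l)))) ∎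

  double-∑-cancel : (f : Fin (suc (suc n)) → Fin (suc n) → Carrier) →
    (∀ {i k j l} → Swap i k j l → f i k + f j l ≈ 0#) → ∑ (λ i → ∑ (f i)) ≈ 0#
  double-∑-cancel {n} f cancel = begin
    ∑ (λ i → ∑ (f i))
      ≈⟨ double-∑-split f ⟩
    ∑ (f zero) + (∑ (λ i → f (suc i) zero) + rest)
      ≈⟨ +-assoc _ _ _ ⟨
    (∑ (f zero) + ∑ (λ i → f (suc i) zero)) + rest
      ≈⟨ +-cong (trans (sym (∑-+ _ _)) (∑-zero λ l → cancel first)) (rest≈0 f cancel) ⟩
    0# + 0#
      ≈⟨ +-identityˡ 0# ⟩
    0# ∎
    where
    rest = ∑ (λ i → ∑ (λ l → f (suc i) (suc l)))
    rest≈0 : {n : ℕ} (f : Fin (suc (suc n)) → Fin (suc n) → Carrier) →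
      (∀ {i k j l} → Swap i k j l → f i k + f j l ≈ 0#) →
      ∑ (λ i → ∑ (λ l → f (suc i) (suc l))) ≈ 0#
    rest≈0 {zero}  f cancel = ∑-zero λ i → ∑-zero λ ()
    rest≈0 {suc n} f cancel = double-∑-cancel (λ i l → f (suc i) (suc l)) (cancel ∘ both)

  double-∑-swap : (f g : Fin (suc (suc n)) → Fin (suc n) → Carrier) →
    (∀ {i k j l} → Swap i k j l → f i k ≈ g j l) → ∑ (λ i → ∑ (f i)) ≈ ∑ (λ i → ∑ (g i))
  double-∑-swap f g f≈g = begin
    ∑ (λ i → ∑ (f i))
      ≈⟨ double-∑-split f ⟩
    ∑ (f zero) + (∑ (λ i → f (suc i) zero) + ∑ (λ i → ∑ (λ l → f (suc i) (suc l))))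
      ≈⟨ +-cong (∑-cong λ _ → f≈g first) (+-cong (∑-cong λ _ → f≈g second) (rest f g f≈g)) ⟩
    ∑ (λ i → g (suc i) zero) + (∑ (g zero) + ∑ (λ i → ∑ (λ l → g (suc i) (suc l))))
      ≈⟨ solve 3 (λ x y z → x :+ (y :+ z) := y :+ (x :+ z)) refl _ _ _ ⟩
    ∑ (g zero) + (∑ (λ i → g (suc i) zero) + ∑ (λ i → ∑ (λ l → g (suc i) (suc l))))
      ≈⟨ double-∑-split g ⟨
    ∑ (λ i → ∑ (g i)) ∎
    where
    rest : {n : ℕ} (f g : Fin (suc (suc n)) → Fin (suc n) → Carrier) →
      (∀ {i k j l} → Swap i k j l → f i k ≈ g j l) →
      ∑ (λ i → ∑ (λ l → f (suc i) (suc l))) ≈ ∑ (λ i → ∑ (λ l → g (suc i) (suc l)))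
    rest {zero}  f g f≈g = ∑-cong λ i → trans (∑-zero λ ()) (sym (∑-zero λ ()))
    rest {suc n} f g f≈g =
      double-∑-swap (λ i l → f (suc i) (suc l)) (λ i l → g (suc i) (suc l)) (f≈g ∘ both)

-- Laplace expansion, adjugates and Cramer's rule

module Determinant (R : CommutativeRing a ℓ) where
  open CommutativeRing R hiding (zero)
  open MatrixOps rawRing
  open Algebra.Properties.Ring ring
    using (-1*x≈-x)
  open Sums R public
  open IntegerCoefficients R
  open Relation.Binary.Reasoning.Setoid setoid

  identity-diagonal : (i : Fin n) → identity i i ≈ 1#
  identity-diagonal i = reflexive
    (≡.cong (if_then 1# else 0#) (dec-true (i Fin.≟ i) ≡.refl))

  identity-off : {i j : Fin n} → i ≢ j → identity i j ≈ 0#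
  identity-off {i = i} {j} i≢j = reflexive
    (≡.cong (if_then 1# else 0#) (dec-false (i Fin.≟ j) i≢j))

  ∑-identity : (i : Fin n) (f : Vector Carrier n) → ∑ (λ k → identity i k * f k) ≈ f i
  ∑-identity i f = begin
    ∑ (λ k → identity i k * f k)
      ≈⟨ ∑-single i (λ k k≢i → trans (*-congʳ (identity-off (k≢i ∘ ≡.sym))) (zeroˡ _)) ⟩
    identity i i * f i
      ≈⟨ trans (*-congʳ (identity-diagonal i)) (*-identityˡ _) ⟩
    f i ∎

  ·-∑ : (M N : Mat n) (i k : Fin n) → (M · N) i k ≈ ∑ (λ j → M i j * N j k)
  ·-∑ M N i k = sym (∑-sum _)

  sign-suc : ∀ k → sign (suc k) ≈ - sign k
  sign-suc k = -1*x≈-x (sign k)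

  sign-+ : ∀ k l → sign (k ℕ.+ l) ≈ sign k * sign l
  sign-+ zero    l = sym (*-identityˡ (sign l))
  sign-+ (suc k) l = trans (*-congˡ (sign-+ k l)) (sym (*-assoc _ _ _))

  -- Deleting the earlier of two columns lowers the position of the later one by one, while deleting
  -- the later one does not move the earlier; the two orders thus differ in parity.
  sign-Swap : {i j : Fin (2 ℕ.+ n)} {k l : Fin (1 ℕ.+ n)} → Swap i k j l →
    sign (toℕ i) * sign (toℕ k) ≈ - (sign (toℕ j) * sign (toℕ l))
  sign-Swap (first {l = l}) = begin
    1# * sign (toℕ l)             ≈⟨ solve 2 (λ x y → x :* y := :- ((:- y) :* x)) refl _ _ ⟩
    - (- sign (toℕ l) * 1#)       ≈⟨ -‿cong (*-congʳ (sign-suc (toℕ l))) ⟨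
    - (sign (suc (toℕ l)) * 1#)   ∎
  sign-Swap (second {l = l}) = begin
    sign (suc (toℕ l)) * 1#       ≈⟨ *-congʳ (sign-suc (toℕ l)) ⟩
    - sign (toℕ l) * 1#           ≈⟨ solve 2 (λ x y → (:- y) :* x := :- (x :* y)) refl _ _ ⟩
    - (1# * sign (toℕ l))         ∎
  sign-Swap (both {a = i} {b = j} {l = k} {m = l} w) = begin
    sign (suc (toℕ i)) * sign (suc (toℕ k))  ≈⟨ *-cong (sign-suc (toℕ i)) (sign-suc (toℕ k)) ⟩
    - sign (toℕ i) * - sign (toℕ k)          ≈⟨ solve 2 (λ x y → (:- x) :* (:- y) := x :* y) refl _ _ ⟩
    sign (toℕ i) * sign (toℕ k)              ≈⟨ sign-Swap w ⟩
    - (sign (toℕ j) * sign (toℕ l))          ≈⟨ -‿cong (solve 2 (λ x y → x :* y := (:- x) :* (:- y)) refl _ _) ⟩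
    - (- sign (toℕ j) * - sign (toℕ l))      ≈⟨ -‿cong (*-cong (sign-suc (toℕ j)) (sign-suc (toℕ l))) ⟨
    - (sign (suc (toℕ j)) * sign (suc (toℕ l))) ∎

  det-suc : (M : Mat (suc n)) →
    det M ≈ ∑ (λ j → sign (toℕ j) * (M zero j * det (minor M zero j)))
  det-suc M = sym (∑-sum _)

  det-cong : {M N : Mat n} → M ≋ N → det M ≈ det N
  det-cong {zero}  M≋N = refl
  det-cong {suc n} {M} {N} M≋N = trans (det-suc M) (trans
    (∑-cong λ j → *-congˡ
      (*-cong (M≋N zero j) (det-cong λ p q → M≋N (suc p) (punchIn j q))))
    (sym (det-suc N)))

  det-identity : ∀ n → det (identity {n}) ≈ 1#
  det-identity zero    = refl
  det-identity (suc n) = begin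
    det (identity {suc n})
      ≈⟨ trans (det-suc (identity {suc n})) (∑-single zero λ
           { zero 0≢0 → contradiction ≡.refl 0≢0 ; (suc j) _ → trans (*-congˡ (zeroˡ _)) (zeroʳ _) }) ⟩
    1# * (1# * det (identity {n}))
      ≈⟨ trans (*-identityˡ _) (trans (*-identityˡ _) (det-identity n)) ⟩
    1# ∎

  RowLaplace : Mat (suc n) → Fin (suc n) → Set ℓ
  RowLaplace M k = det M ≈ ∑ (λ j → sign (toℕ k ℕ.+ toℕ j) * (M k j * det (minor M k j)))

  laplaceTerm : Mat (suc (suc n)) → Fin (suc n) → Fin (suc (suc n)) → Fin (suc n) → Carrier
  laplaceTerm M k i l = sign (toℕ i) * (M zero i * (sign (toℕ k ℕ.+ toℕ l) *
    (M (suc k) (punchIn i l) * det (minor (minor M zero i) k l))))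

  -- Row k + 1 of `M` is row k of every first-row minor. The expansion of these minors is a
  -- hypothesis so that `laplace` can supply it by its own recursion.
  det-two-rows : (M : Mat (suc (suc n))) (k : Fin (suc n)) →
    (∀ i → RowLaplace (minor M zero i) k) →
    det M ≈ ∑ (λ i → ∑ (laplaceTerm M k i))
  det-two-rows M k laplace = trans (det-suc M) (∑-cong λ i → begin
    sign (toℕ i) * (M zero i * det (minor M zero i))
      ≈⟨ *-congˡ (*-congˡ (laplace i)) ⟩
    sign (toℕ i) * (M zero i * ∑ (λ l → sign (toℕ k ℕ.+ toℕ l) *
      (M (suc k) (punchIn i l) * det (minor (minor M zero i) k l))))
      ≈⟨ *-*-∑ (sign (toℕ i)) (M zero i) _ ⟩
    ∑ (laplaceTerm M k i) ∎)

  -- Reads the same two columns with row k + 1 outermost. The minus sign turns sign k into sign (k +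
  -- 1) in `laplace` and produces the cancellation in `det-equal-first-row`.
  laplaceTerm-Swap : (M : Mat (suc (suc n))) (k : Fin (suc n)) →
    ∀ {i r j l} → Swap i r j l →
    laplaceTerm M k i r ≈
    - sign (toℕ k ℕ.+ toℕ j) * (M (suc k) j * (sign (toℕ l) *
      (M zero (punchIn j l) * det (minor (minor M (suc k) j) zero l))))
  laplaceTerm-Swap M k {i} {r} {j} {l} w = begin
    sign (toℕ i) * (M zero i * (sign (toℕ k ℕ.+ toℕ r) * (M (suc k) (punchIn i r) * d₁)))
      ≈⟨ *-congˡ (*-cong (reflexive (≡.cong (M zero) (≡.sym (punchIn-Swap (Swap-sym w)))))
           (*-cong (sign-+ (toℕ k) (toℕ r))
             (*-cong (reflexive (≡.cong (M (suc k)) (punchIn-Swap w)))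
               (det-cong λ p q → reflexive
                 (≡.cong (M (suc (punchIn k p))) (punchIn-punchIn-Swap w q)))))) ⟩
    sign (toℕ i) * (x * (sign (toℕ k) * sign (toℕ r) * (y * d₂)))
      ≈⟨ solve 6 (λ si sk sr x y d → si :* (x :* (sk :* sr :* (y :* d))) :=
           (si :* sr) :* (sk :* (x :* (y :* d)))) refl _ _ _ _ _ _ ⟩
    (sign (toℕ i) * sign (toℕ r)) * (sign (toℕ k) * (x * (y * d₂)))
      ≈⟨ *-congʳ (sign-Swap w) ⟩
    - (sign (toℕ j) * sign (toℕ l)) * (sign (toℕ k) * (x * (y * d₂)))
      ≈⟨ solve 6 (λ sj sk sl x y d → (:- (sj :* sl)) :* (sk :* (x :* (y :* d))) :=
           (:- (sk :* sj)) :* (y :* (sl :* (x :* d)))) refl _ _ _ _ _ _ ⟩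
    - (sign (toℕ k) * sign (toℕ j)) * (y * (sign (toℕ l) * (x * d₂)))
      ≈⟨ *-congʳ (-‿cong (sign-+ (toℕ k) (toℕ j))) ⟨
    - sign (toℕ k ℕ.+ toℕ j) * (y * (sign (toℕ l) * (x * d₂))) ∎
    where
    x  = M zero (punchIn j l)
    y  = M (suc k) j
    d₁ = det (minor (minor M zero i) k r)
    d₂ = det (minor (minor M (suc k) j) zero l)

  laplace : (M : Mat (suc n)) (k : Fin (suc n)) → RowLaplace M k
  laplace         M zero    = det-suc M
  laplace {suc n} M (suc k) = begin
    det M
      ≈⟨ det-two-rows M k (λ i → laplace (minor M zero i) k) ⟩
    ∑ (λ i → ∑ (laplaceTerm M k i))
      ≈⟨ double-∑-swap (laplaceTerm M k) g (λ {i} {r} {j} w →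
           trans (laplaceTerm-Swap M k w) (*-congʳ (sym (sign-suc (toℕ k ℕ.+ toℕ j))))) ⟩
    ∑ (λ j → ∑ (g j))
      ≈⟨ ∑-cong (λ j → trans
           (*-congˡ (*-congˡ (det-suc (minor M (suc k) j))))
           (*-*-∑ (sign (suc (toℕ k ℕ.+ toℕ j))) (M (suc k) j) _)) ⟨
    ∑ (λ j → sign (suc (toℕ k ℕ.+ toℕ j)) * (M (suc k) j * det (minor M (suc k) j))) ∎
    where
    g : Fin (suc (suc n)) → Fin (suc n) → Carrier
    g j l = sign (suc (toℕ k ℕ.+ toℕ j)) * (M (suc k) j * (sign (toℕ l) *
      (M zero (punchIn j l) * det (minor (minor M (suc k) j) zero l))))

  -- With equal rows, the terms of a pair of columns and of its reverse are opposite. Cancelling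
  -- them in pairs avoids the division by two hidden in det M = - det M.
  det-equal-first-row : (M : Mat (suc n)) {k : Fin n} →
                        (∀ q → M zero q ≈ M (suc k) q) → det M ≈ 0#
  det-equal-first-row {suc n} M {k} M₀≈Mₖ = begin
    det M
      ≈⟨ det-two-rows M k (λ i → laplace (minor M zero i) k) ⟩
    ∑ (λ i → ∑ (laplaceTerm M k i))
      ≈⟨ double-∑-cancel (laplaceTerm M k) cancel ⟩
    0# ∎
    where
    cancel : ∀ {i r j l} → Swap i r j l → laplaceTerm M k i r + laplaceTerm M k j l ≈ 0#
    cancel {i} {r} {j} {l} w = begin
      laplaceTerm M k i r + laplaceTerm M k j l
        ≈⟨ +-cong (laplaceTerm-Swap M k w) (*-congˡ (*-cong (M₀≈Mₖ j)
             (*-cong (sign-+ (toℕ k) (toℕ l)) (*-congʳ (sym (M₀≈Mₖ (punchIn j l))))))) ⟩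
      - sign (toℕ k ℕ.+ toℕ j) * (y * (sign (toℕ l) * (x * d))) +
      sign (toℕ j) * (y * (sign (toℕ k) * sign (toℕ l) * (x * d′)))
        ≈⟨ +-cong (*-congʳ (-‿cong (sign-+ (toℕ k) (toℕ j)))) refl ⟩
      - (sign (toℕ k) * sign (toℕ j)) * (y * (sign (toℕ l) * (x * d))) +
      sign (toℕ j) * (y * (sign (toℕ k) * sign (toℕ l) * (x * d)))
        ≈⟨ solve 6 (λ sk sj sl x y d → (:- (sk :* sj)) :* (y :* (sl :* (x :* d))) :+
             sj :* (y :* (sk :* sl :* (x :* d))) := d :- d) refl _ _ _ _ _ _ ⟩
      d - d
        ≈⟨ -‿inverseʳ d ⟩
      0# ∎
      where
      x  = M zero (punchIn j l)
      y  = M (suc k) j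
      d  = det (minor (minor M (suc k) j) zero l)
      d′ = det (minor (minor M zero j) k l)

  det-equal-rows : (M : Mat n) {i j : Fin n} → i ≢ j → (∀ q → M i q ≈ M j q) → det M ≈ 0#
  det-equal-rows M {zero}  {zero}  i≢j Mi≈Mj = contradiction ≡.refl i≢j
  det-equal-rows M {zero}  {suc j} i≢j Mi≈Mj = det-equal-first-row M Mi≈Mj
  det-equal-rows M {suc i} {zero}  i≢j Mi≈Mj = det-equal-first-row M (sym ∘ Mi≈Mj)
  det-equal-rows M {suc i} {suc j} i≢j Mi≈Mj = trans (det-suc M) (∑-zero λ q → trans
    (*-congˡ (trans
      (*-congˡ (det-equal-rows (minor M zero q) (i≢j ∘ ≡.cong suc) (λ r → Mi≈Mj (punchIn q r))))
      (zeroʳ _)))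
    (zeroʳ _))

  replaceRow : Mat n → Fin n → Vector Carrier n → Mat n
  replaceRow M k v = updateAt M k (const v)

  replaceRow-updates : (M : Mat n) (k : Fin n) (v : Vector Carrier n) → ∀ j → replaceRow M k v k j ≡ v j
  replaceRow-updates M k v j = ≡.cong (λ r → r j) (updateAt-updates k M)

  replaceRow-minimal : (M : Mat n) {i k : Fin n} (v : Vector Carrier n) →
                       i ≢ k → ∀ j → replaceRow M k v i j ≡ M i j
  replaceRow-minimal M {i} {k} v i≢k j = ≡.cong (λ r → r j) (updateAt-minimal i k M i≢k)

  -- Row k does not enter its own cofactors, so column k of the adjugate serves every `v`.
  det-replaceRow : (M : Mat n) (k : Fin n) (v : Vector Carrier n) →
                   det (replaceRow M k v) ≈ ∑ (λ j → v j * adjugate M j k)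
  det-replaceRow {suc n} M k v = trans (laplace (replaceRow M k v) k) (∑-cong λ j → begin
    sign (toℕ k ℕ.+ toℕ j) * (replaceRow M k v k j * det (minor (replaceRow M k v) k j))
      ≈⟨ *-cong (reflexive (≡.cong sign (ℕ.+-comm (toℕ k) (toℕ j))))
           (*-cong (reflexive (replaceRow-updates M k v j))
             (det-cong λ p q → reflexive (replaceRow-minimal M v (Fin.punchInᵢ≢i k p) (punchIn j q)))) ⟩
    sign (toℕ j ℕ.+ toℕ k) * (v j * det (minor M k j))
      ≈⟨ solve 3 (λ x y z → x :* (y :* z) := y :* (x :* z)) refl _ _ _ ⟩
    v j * adjugate M j k ∎)

  ·-adjugate-diagonal : (M : Mat n) (k : Fin n) → (M · adjugate M) k k ≈ det M
  ·-adjugate-diagonal {suc n} M k = trans (·-∑ M (adjugate M) k k) (sym (trans (laplace M k) (∑-cong λ j →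
    trans (*-congʳ (reflexive (≡.cong sign (ℕ.+-comm (toℕ k) (toℕ j)))))
          (solve 3 (λ x y z → x :* (y :* z) := y :* (x :* z)) refl _ _ _))))

  -- This entry is the determinant of `M` with row k overwritten by row i, which has two equal rows.
  ·-adjugate-off : (M : Mat n) {i k : Fin n} → i ≢ k → (M · adjugate M) i k ≈ 0#
  ·-adjugate-off M {i} {k} i≢k = trans
    (trans (·-∑ M (adjugate M) i k) (sym (det-replaceRow M k (M i))))
    (det-equal-rows (replaceRow M k (M i)) i≢k λ q → reflexive
      (≡.trans (replaceRow-minimal M (M i) i≢k q) (≡.sym (replaceRow-updates M k (M i) q))))

  -- The corner term is common to both expansions. In the others, expanding the first row and then
  -- the first column of the minors gives terms symmetric in the two operations.
  laplace-firstColumn : (M : Mat (suc n)) →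
    det M ≈ ∑ (λ i → sign (toℕ i) * (M i zero * det (minor M i zero)))
  laplace-firstColumn {zero}  M = trans (det-suc M) (∑-cong λ { zero → refl })
  laplace-firstColumn {suc n} M =
    trans (det-suc M) (trans (∑-suc _) (trans (+-congˡ tails) (sym (∑-suc _))))
    where
    d : Fin (suc n) → Fin (suc n) → Mat n
    d i j p q = M (suc (punchIn i p)) (suc (punchIn j q))
    rearrange : ∀ i j →
      sign (suc (toℕ j)) * (M zero (suc j) * (sign (toℕ i) * (M (suc i) zero * det (d i j)))) ≈
      sign (suc (toℕ i)) * (M (suc i) zero * (sign (toℕ j) * (M zero (suc j) * det (d i j))))
    rearrange i j = solve 6 (λ u si sj x y d →
      (u :* sj) :* (x :* (si :* (y :* d))) := (u :* si) :* (y :* (sj :* (x :* d))))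
      refl (- 1#) (sign (toℕ i)) (sign (toℕ j)) _ _ _
    tails : ∑ (λ j → sign (suc (toℕ j)) * (M zero (suc j) * det (minor M zero (suc j)))) ≈
            ∑ (λ i → sign (suc (toℕ i)) * (M (suc i) zero * det (minor M (suc i) zero)))
    tails = begin
      ∑ (λ j → sign (suc (toℕ j)) * (M zero (suc j) * det (minor M zero (suc j))))
        ≈⟨ ∑-cong (λ j → trans
             (*-congˡ (*-congˡ (laplace-firstColumn (minor M zero (suc j)))))
             (*-*-∑ (sign (suc (toℕ j))) (M zero (suc j)) _)) ⟩
      ∑ (λ j → ∑ (λ i → sign (suc (toℕ j)) * (M zero (suc j) *
        (sign (toℕ i) * (M (suc i) zero * det (d i j))))))
        ≈⟨ ∑-exchange _ ⟩
      ∑ (λ i → ∑ (λ j → sign (suc (toℕ j)) * (M zero (suc j) *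
        (sign (toℕ i) * (M (suc i) zero * det (d i j))))))
        ≈⟨ ∑-cong (λ i → ∑-cong λ j → rearrange i j) ⟩
      ∑ (λ i → ∑ (λ j → sign (suc (toℕ i)) * (M (suc i) zero *
        (sign (toℕ j) * (M zero (suc j) * det (d i j))))))
        ≈⟨ ∑-cong (λ i → trans
             (*-congˡ (*-congˡ (det-suc (minor M (suc i) zero))))
             (*-*-∑ (sign (suc (toℕ i))) (M (suc i) zero) _)) ⟨
      ∑ (λ i → sign (suc (toℕ i)) * (M (suc i) zero * det (minor M (suc i) zero))) ∎

  det-transpose : (M : Mat n) → det (transpose M) ≈ det M
  det-transpose {zero}  M = refl
  det-transpose {suc n} M = trans (det-suc (transpose M)) (trans
    (∑-cong λ j → *-congˡ (*-congˡ (det-transpose (minor M j zero))))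
    (sym (laplace-firstColumn M)))

  adjugate-transpose : (M : Mat n) → adjugate (transpose M) ≋ transpose (adjugate M)
  adjugate-transpose {suc n} M i j =
    *-cong (reflexive (≡.cong sign (ℕ.+-comm (toℕ i) (toℕ j)))) (det-transpose (minor M i j))

  adjugate-cong : {M N : Mat n} → M ≋ N → adjugate M ≋ adjugate N
  adjugate-cong {suc n} M≋N i j = *-congˡ (det-cong λ p q → M≋N (punchIn j p) (punchIn i q))

  adjugate-symmetric : {M : Mat n} → IsSymmetric M → IsSymmetric (adjugate M)
  adjugate-symmetric {M = M} sym-M i j = trans (adjugate-cong sym-M i j) (adjugate-transpose M i j)

  -- Transposition reverses the product, so the row expansions also evaluate adj M · M.
  adjugate-·-transpose : (M : Mat n) (i k : Fin n) →
    (adjugate M · M) i k ≈ (transpose M · adjugate (transpose M)) k i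
  adjugate-·-transpose M i k = trans (·-∑ (adjugate M) M i k) (trans
    (∑-cong λ j → trans (*-comm _ _) (*-congˡ (sym (adjugate-transpose M j i))))
    (sym (·-∑ (transpose M) (adjugate (transpose M)) k i)))

  det-kernel : (M : Mat n) (v : Vector Carrier n) →
               (∀ i → ∑ (λ j → M i j * v j) ≈ 0#) → ∀ k → det M * v k ≈ 0#
  det-kernel {n} M v Mv≈0 k = begin
    det M * v k
      ≈⟨ *-congʳ (trans (adjugate-·-transpose M k k)
           (trans (·-adjugate-diagonal (transpose M) k) (det-transpose M))) ⟨
    (adjugate M · M) k k * v k
      ≈⟨ ∑-single k (λ i i≢k → trans
           (*-congʳ (trans (adjugate-·-transpose M k i) (·-adjugate-off (transpose M) i≢k)))
           (zeroˡ (v i))) ⟨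
    ∑ (λ i → (adjugate M · M) k i * v i)
      ≈⟨ ∑-cong (λ i → trans (*-congʳ (·-∑ (adjugate M) M k i)) (*-∑ʳ (v i) _)) ⟩
    ∑ (λ i → ∑ (λ j → adjugate M k j * M j i * v i))
      ≈⟨ ∑-exchange _ ⟩
    ∑ (λ j → ∑ (λ i → adjugate M k j * M j i * v i))
      ≈⟨ ∑-cong (λ j → trans (∑-cong λ i → *-assoc _ _ _) (sym (*-∑ˡ (adjugate M k j) _))) ⟩
    ∑ (λ j → adjugate M k j * ∑ (λ i → M j i * v i))
      ≈⟨ ∑-zero (λ j → trans (*-congˡ (Mv≈0 j)) (zeroʳ _)) ⟩
    0# ∎

  ∑-two-terms : (i q : Fin n) (x y : Carrier) (f : Vector Carrier n) →
    ∑ (λ l → (identity i l * x - identity q l * y) * f l) ≈ f i * x - f q * y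
  ∑-two-terms i q x y f = begin
    ∑ (λ l → (identity i l * x - identity q l * y) * f l)
      ≈⟨ ∑-cong (λ l → solve 5 (λ a b x y z →
           (a :* x :- b :* y) :* z := a :* z :* x :+ b :* z :* (:- y)) refl _ _ _ _ _) ⟩
    ∑ (λ l → identity i l * f l * x + identity q l * f l * - y)
      ≈⟨ ∑-+ _ _ ⟩
    ∑ (λ l → identity i l * f l * x) + ∑ (λ l → identity q l * f l * - y)
      ≈⟨ +-cong (*-∑ʳ x _) (*-∑ʳ (- y) _) ⟨
    ∑ (λ l → identity i l * f l) * x + ∑ (λ l → identity q l * f l) * - y
      ≈⟨ +-cong (*-congʳ (∑-identity i f)) (*-congʳ (∑-identity q f)) ⟩
    f i * x + f q * - y
      ≈⟨ solve 4 (λ a b x y → a :* x :+ b :* (:- y) := a :* x :- b :* y) refl _ _ _ _ ⟩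
    f i * x - f q * y ∎

  -- Replacing row r of M by v q · eᵢ − v i · e_q gives a matrix that still
  -- annihilates v.
  adjugate-kernel : (M : Mat n) (v : Vector Carrier n) →
    (∀ i → ∑ (λ j → M i j * v j) ≈ 0#) →
    ∀ i q r k → (adjugate M i r * v q - adjugate M q r * v i) * v k ≈ 0#
  adjugate-kernel {n} M v Mv≈0 i q r k = begin
    (adjugate M i r * v q - adjugate M q r * v i) * v k
      ≈⟨ *-congʳ (∑-two-terms i q (v q) (v i) (λ l → adjugate M l r)) ⟨
    ∑ (λ l → w l * adjugate M l r) * v k
      ≈⟨ *-congʳ (det-replaceRow M r w) ⟨
    det (replaceRow M r w) * v k
      ≈⟨ det-kernel (replaceRow M r w) v kernel k ⟩
    0# ∎
    where
    w : Vector Carrier n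
    w l = identity i l * v q - identity q l * v i
    kernel : ∀ p → ∑ (λ l → replaceRow M r w p l * v l) ≈ 0#
    kernel p with p Fin.≟ r
    ... | yes ≡.refl = begin
      ∑ (λ l → replaceRow M p w p l * v l)
        ≈⟨ ∑-cong (λ l → *-congʳ (reflexive (replaceRow-updates M p w l))) ⟩
      ∑ (λ l → w l * v l)
        ≈⟨ ∑-two-terms i q (v q) (v i) v ⟩
      v i * v q - v q * v i
        ≈⟨ +-congˡ (-‿cong (*-comm (v q) (v i))) ⟩
      v i * v q - v i * v q
        ≈⟨ -‿inverseʳ _ ⟩
      0# ∎
    ... | no p≢r = trans
      (∑-cong λ l → *-congʳ (reflexive (replaceRow-minimal M w p≢r l))) (Mv≈0 p)

  -- When det M = 0, every column of adj M lies in the kernel of `M`, so `adjugate-kernel` applies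
  -- to it. The last factor replaces a choice of nonzero entry and keeps the statement valid over
  -- any commutative ring.
  adjugate-rank-one : (M : Mat n) → det M ≈ 0# → ∀ i q r k j →
    (adjugate M i r * adjugate M q k - adjugate M q r * adjugate M i k) * adjugate M j k ≈ 0#
  adjugate-rank-one M detM≈0 i q r k =
    adjugate-kernel M (λ l → adjugate M l k) M·adj≈0 i q r
    where
    M·adj≈0 : ∀ p → ∑ (λ l → M p l * adjugate M l k) ≈ 0#
    M·adj≈0 p with p Fin.≟ k
    ... | yes ≡.refl = trans (sym (·-∑ M (adjugate M) p p)) (trans (·-adjugate-diagonal M p) detM≈0)
    ... | no p≢k     = trans (sym (·-∑ M (adjugate M) p k)) (·-adjugate-off M p≢k)

-- Ring homomorphisms and evaluation of polynomials

module RingHomomorphism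
  (S : RawRing a₁ ℓ₁) (R : CommutativeRing a₂ ℓ₂)
  {φ : RawRing.Carrier S → CommutativeRing.Carrier R}
  (φ-homo : RingMorphisms.IsRingHomomorphism S (CommutativeRing.rawRing R) φ)
  where
  private
    module S where
      open RawRing S public
      open MatrixOps S public
      open Algebra.Definitions.RawSemiring rawSemiring public using (sum; product)
  open CommutativeRing R hiding (zero)
  open MatrixOps rawRing
  open Algebra.Definitions.RawSemiring (RawRing.rawSemiring rawRing) using (product)
  open Determinant R using (∑; ∑-suc; ∑-zero; ∑-cong; det-suc)
  open RingMorphisms.IsRingHomomorphism φ-homo

  sum-homo : (f : Vector S.Carrier n) → φ (S.sum f) ≈ ∑ (φ ∘ f)
  sum-homo {zero}  f = trans 0#-homo (sym (∑-zero λ ()))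
  sum-homo {suc n} f = trans (+-homo _ _) (trans (+-congˡ (sum-homo (f ∘ suc))) (sym (∑-suc (φ ∘ f))))

  product-homo : (f : Vector S.Carrier n) → φ (S.product f) ≈ product (φ ∘ f)
  product-homo {zero}  f = 1#-homo
  product-homo {suc n} f = trans (*-homo _ _) (*-congˡ (product-homo (f ∘ suc)))

  sign-homo : ∀ k → φ (S.sign k) ≈ sign k
  sign-homo zero    = 1#-homo
  sign-homo (suc k) = trans (*-homo _ _)
    (*-cong (trans (-‿homo _) (-‿cong 1#-homo)) (sign-homo k))

  -- The source is only a `RawRing`, so this applies to list polynomials with no ring axioms
  -- established for them.
  det-homo : (M : S.Mat n) → φ (S.det M) ≈ det (mapMatrix φ M)
  det-homo {zero}  M = 1#-homo
  det-homo {suc n} M = trans (sum-homo _) (trans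
    (∑-cong λ j → trans (*-homo _ _) (*-cong (sign-homo (toℕ j))
      (trans (*-homo _ _) (*-congˡ (det-homo (S.minor M zero j))))))
    (sym (det-suc (mapMatrix φ M))))

module Evaluation
  (S : RawRing a₁ ℓ₁) (R : CommutativeRing a₂ ℓ₂)
  (φ : RawRing.Carrier S → CommutativeRing.Carrier R)
  (x : CommutativeRing.Carrier R)
  where
  private
    module S = RawRing S
    module S[x] = RawRing (polynomialRing S)
  open CommutativeRing R hiding (zero)
  open Algebra.Properties.Ring ring using (-0#≈0#)
  open IntegerCoefficients R
  open Relation.Binary.Reasoning.Setoid setoid

  eval : List S.Carrier → Carrier
  eval []      = 0#
  eval (c ∷ p) = φ c + x * eval p

  module _ (φ-homo : RingMorphisms.IsRingHomomorphism S (CommutativeRing.rawRing R) φ) where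
    open RingMorphisms.IsRingHomomorphism φ-homo

    eval-cong : ∀ p q → p S[x].≈ q → eval p ≈ eval q
    eval-cong []      []      p≈q = refl
    eval-cong (c ∷ p) (d ∷ q) p≈q =
      +-cong (⟦⟧-cong (p≈q 0)) (*-congˡ (eval-cong p q (p≈q ∘ suc)))
    -- Trailing zeros let lists of different lengths be equal, so the empty list is compared further
    -- until the longer one is exhausted.
    eval-cong []      (d ∷ q) p≈q = begin
      0#                ≈⟨ trans (+-congˡ (zeroʳ x)) (+-identityˡ 0#) ⟨
      0# + x * 0#       ≈⟨ +-cong (sym (trans (sym (⟦⟧-cong (p≈q 0))) 0#-homo))
                             (*-congˡ (eval-cong [] q (p≈q ∘ suc))) ⟩
      φ d + x * eval q  ∎
    eval-cong (c ∷ p) []      p≈q = begin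
      φ c + x * eval p  ≈⟨ +-cong (trans (⟦⟧-cong (p≈q 0)) 0#-homo)
                             (*-congˡ (eval-cong p [] (p≈q ∘ suc))) ⟩
      0# + x * 0#       ≈⟨ trans (+-congˡ (zeroʳ x)) (+-identityˡ 0#) ⟩
      0#                ∎

    eval-+ : ∀ p q → eval (p S[x].+ q) ≈ eval p + eval q
    eval-+ []      q       = sym (+-identityˡ (eval q))
    eval-+ (c ∷ p) []      = sym (+-identityʳ _)
    eval-+ (c ∷ p) (d ∷ q) = begin
      φ (c S.+ d) + x * eval (p S[x].+ q)
        ≈⟨ +-cong (+-homo c d) (*-congˡ (eval-+ p q)) ⟩
      (φ c + φ d) + x * (eval p + eval q)
        ≈⟨ solve 5 (λ c d x p q → (c :+ d) :+ x :* (p :+ q) := (c :+ x :* p) :+ (d :+ x :* q))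
             refl (φ c) (φ d) x (eval p) (eval q) ⟩
      (φ c + x * eval p) + (φ d + x * eval q) ∎

    eval-scale : ∀ c q → eval (List.map (c S.*_) q) ≈ φ c * eval q
    eval-scale c []      = sym (zeroʳ (φ c))
    eval-scale c (d ∷ q) = begin
      φ (c S.* d) + x * eval (List.map (c S.*_) q)
        ≈⟨ +-cong (*-homo c d) (*-congˡ (eval-scale c q)) ⟩
      φ c * φ d + x * (φ c * eval q)
        ≈⟨ solve 4 (λ c d x q → c :* d :+ x :* (c :* q) := c :* (d :+ x :* q))
             refl (φ c) (φ d) x (eval q) ⟩
      φ c * (φ d + x * eval q) ∎

    eval-* : ∀ p q → eval (p S[x].* q) ≈ eval p * eval q
    eval-* []      q = sym (zeroˡ (eval q))
    eval-* (c ∷ p) q = begin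
      eval (List.map (c S.*_) q S[x].+ (S.0# ∷ p S[x].* q))
        ≈⟨ eval-+ (List.map (c S.*_) q) _ ⟩
      eval (List.map (c S.*_) q) + (φ S.0# + x * eval (p S[x].* q))
        ≈⟨ +-cong (eval-scale c q) (trans (+-congʳ 0#-homo) (trans (+-identityˡ _) (*-congˡ (eval-* p q)))) ⟩
      φ c * eval q + x * (eval p * eval q)
        ≈⟨ solve 4 (λ c x p q → c :* q :+ x :* (p :* q) := (c :+ x :* p) :* q)
             refl (φ c) x (eval p) (eval q) ⟩
      (φ c + x * eval p) * eval q ∎

    eval-neg : ∀ p → eval (S[x].- p) ≈ - eval p
    eval-neg []      = sym -0#≈0#
    eval-neg (c ∷ p) = begin
      φ (S.- c) + x * eval (S[x].- p)  ≈⟨ +-cong (-‿homo c) (*-congˡ (eval-neg p)) ⟩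
      - φ c + x * - eval p
        ≈⟨ solve 3 (λ c x p → :- c :+ x :* (:- p) := :- (c :+ x :* p)) refl (φ c) x (eval p) ⟩
      - (φ c + x * eval p)             ∎

    eval-constant : ∀ c → eval (c ∷ []) ≈ φ c
    eval-constant c = trans (+-congˡ (zeroʳ x)) (+-identityʳ (φ c))

    eval-isRingHomomorphism :
      RingMorphisms.IsRingHomomorphism (polynomialRing S) rawRing eval
    eval-isRingHomomorphism = record
      { isSemiringHomomorphism = record
        { isNearSemiringHomomorphism = record
          { +-isMonoidHomomorphism = record
            { isMagmaHomomorphism = record
              { isRelHomomorphism = record { cong = λ {p} {q} → eval-cong p q }
              ; homo = eval-+ }
            ; ε-homo = refl }
          ; *-homo = eval-* }
        ; 1#-homo = trans (eval-constant S.1#) 1#-homo }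
      ; -‿homo = eval-neg }

module BinaryEvaluation
  (S : RawRing a₁ ℓ₁) (R : CommutativeRing a₂ ℓ₂)
  (φ : RawRing.Carrier S → CommutativeRing.Carrier R)
  (x y : CommutativeRing.Carrier R)
  where
  open CommutativeRing R hiding (zero)
  open Evaluation S R φ x using () renaming (eval to evalˣ) public
  open Evaluation (polynomialRing S) R evalˣ y using () renaming (eval to eval₂) public
  open BinaryForms S
  open Relation.Binary.Reasoning.Setoid setoid
  open MatrixOps rawRing using (det)
  open Algebra.Definitions.RawSemiring (RawRing.rawSemiring rawRing) using (product)
  open Algebra.Definitions.RawSemiring (RawRing.rawSemiring (polynomialRing₂ S)) using ()
    renaming (product to product₂)

  module _ (φ-homo : RingMorphisms.IsRingHomomorphism S (CommutativeRing.rawRing R) φ) where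
    private
      evalˣ-homo = Evaluation.eval-isRingHomomorphism S R φ x φ-homo

    open RingMorphisms.IsRingHomomorphism φ-homo using (0#-homo; 1#-homo)

    eval₂-isRingHomomorphism :
      RingMorphisms.IsRingHomomorphism (polynomialRing₂ S) rawRing eval₂
    eval₂-isRingHomomorphism =
      Evaluation.eval-isRingHomomorphism (polynomialRing S) R evalˣ y evalˣ-homo

    eval₂-cong : ∀ p q → RawRing._≈_ (polynomialRing₂ S) p q → eval₂ p ≈ eval₂ q
    eval₂-cong = Evaluation.eval-cong (polynomialRing S) R evalˣ y evalˣ-homo

    open RingMorphisms.IsRingHomomorphism eval₂-isRingHomomorphism using (+-homo; *-homo; -‿homo)

    private
      evalˣ-constant = Evaluation.eval-constant S R φ x φ-homo
      evalʸ-constant = Evaluation.eval-constant (polynomialRing S) R evalˣ y evalˣ-homo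
      module S = RawRing S

    eval₂-constant : ∀ c → eval₂ (constant c) ≈ φ c
    eval₂-constant c = trans (evalʸ-constant (c ∷ [])) (evalˣ-constant c)

    eval₂-varX : eval₂ varX ≈ x
    eval₂-varX = begin
      eval₂ varX                        ≈⟨ evalʸ-constant (S.0# ∷ S.1# ∷ []) ⟩
      φ S.0# + x * evalˣ (S.1# ∷ [])    ≈⟨ +-cong 0#-homo (*-congˡ (trans (evalˣ-constant S.1#) 1#-homo)) ⟩
      0# + x * 1#                       ≈⟨ trans (+-identityˡ _) (*-identityʳ x) ⟩
      x                                 ∎

    eval₂-varY : eval₂ varY ≈ y
    eval₂-varY = begin
      0# + y * eval₂ (constant S.1#)    ≈⟨ +-identityˡ _ ⟩
      y * eval₂ (constant S.1#)         ≈⟨ *-congˡ (trans (eval₂-constant S.1#) 1#-homo) ⟩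
      y * 1#                            ≈⟨ *-identityʳ y ⟩
      y                                 ∎

    eval₂-binaryLinear : ∀ s t → eval₂ (binaryLinear s t) ≈ φ s * x - φ t * y
    eval₂-binaryLinear s t = trans (+-homo (constant s P.* varX) (P.- (constant t P.* varY)))
      (+-cong (trans (*-homo (constant s) varX) (*-cong (eval₂-constant s) eval₂-varX))
        (trans (-‿homo (constant t P.* varY)) (-‿cong
          (trans (*-homo (constant t) varY) (*-cong (eval₂-constant t) eval₂-varY)))))
      where module P = RawRing (polynomialRing₂ S)

    eval₂-pencilForm : (A B : Matrix (RawRing.Carrier S) n) →
      eval₂ (pencilForm A B) ≈ det (λ i j → φ (A i j) * x - φ (B i j) * y)
    eval₂-pencilForm A B = trans
      (RingHomomorphism.det-homo (polynomialRing₂ S) R eval₂-isRingHomomorphism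
        (λ i j → binaryLinear (A i j) (B i j)))
      (Determinant.det-cong R λ i j → eval₂-binaryLinear (A i j) (B i j))

    eval₂-product : (s t : Vector S.Carrier n) →
      eval₂ (product₂ (λ j → binaryLinear (s j) (t j))) ≈
      product (λ j → φ (s j) * x - φ (t j) * y)
    eval₂-product s t = trans
      (RingHomomorphism.product-homo (polynomialRing₂ S) R eval₂-isRingHomomorphism
        (λ j → binaryLinear (s j) (t j)))
      (Algebra.Properties.Monoid.Sum.sum-cong-≋ *-monoid λ j → eval₂-binaryLinear (s j) (t j))


-- Dual numbers and the derivative of the determinant

module DualNumbers (R : CommutativeRing a ℓ) where
  open CommutativeRing R hiding (zero)
  open IntegerCoefficients R
  open Determinant R
  open MatrixOps rawRing
  open Relation.Binary.Reasoning.Setoid setoid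

  -- The pair (x , y) stands for x + y ε with ε² = 0.
  dualNumbers : CommutativeRing a ℓ
  dualNumbers = record
    { isCommutativeRing = record
      { isRing = Idealization.isRingᴺ ring TensorUnit.bimodule
      ; *-comm = λ (w , x) (y , z) → *-comm w y ,
          solve 4 (λ w x y z → w :* z :+ x :* y := y :* x :+ z :* w) refl w x y z
      }
    }

  private
    module D where
      open CommutativeRing dualNumbers public
      open MatrixOps (CommutativeRing.rawRing dualNumbers) public
      open Determinant dualNumbers public

  ι : Carrier → D.Carrier
  ι x = x , 0#

  ι-isRingHomomorphism : RingMorphisms.IsRingHomomorphism rawRing D.rawRing ι
  ι-isRingHomomorphism = record
    { isSemiringHomomorphism = record
      { isNearSemiringHomomorphism = record
        { +-isMonoidHomomorphism = record
          { isMagmaHomomorphism = record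
            { isRelHomomorphism = record { cong = λ x≈y → x≈y , refl }
            ; homo = λ x y → refl , sym (+-identityˡ 0#) }
          ; ε-homo = refl , refl }
        ; *-homo = λ x y → refl , sym (trans (+-cong (zeroʳ x) (zeroˡ y)) (+-identityˡ 0#)) }
      ; 1#-homo = refl , refl }
    ; -‿homo = λ x → refl , sym (Algebra.Properties.Ring.-0#≈0# ring) }

  proj₁-isRingHomomorphism : RingMorphisms.IsRingHomomorphism D.rawRing rawRing proj₁
  proj₁-isRingHomomorphism = record
    { isSemiringHomomorphism = record
      { isNearSemiringHomomorphism = record
        { +-isMonoidHomomorphism = record
          { isMagmaHomomorphism = record
            { isRelHomomorphism = record { cong = proj₁ }
            ; homo = λ x y → refl }
          ; ε-homo = refl }
        ; *-homo = λ x y → refl }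
      ; 1#-homo = refl }
    ; -‿homo = λ x → refl }

  det-proj₁ : (X : D.Mat n) → proj₁ (D.det X) ≈ det (mapMatrix proj₁ X)
  det-proj₁ = RingHomomorphism.det-homo D.rawRing R proj₁-isRingHomomorphism

  ∑-proj₂ : (f : Vector D.Carrier n) → proj₂ (D.∑ f) ≈ ∑ (proj₂ ∘ f)
  ∑-proj₂ {zero}  f = trans (proj₂ (D.∑-zero {f = f} λ ())) (sym (∑-zero λ ()))
  ∑-proj₂ {suc n} f = trans (proj₂ (D.∑-suc f))
    (trans (+-congˡ (∑-proj₂ (f ∘ suc))) (sym (∑-suc (proj₂ ∘ f))))

  sign-ι : ∀ k → D.sign k D.≈ ι (sign k)
  sign-ι k = D.sym (RingHomomorphism.sign-homo rawRing dualNumbers ι-isRingHomomorphism k)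

  minor-replaceRow : (M : Mat (suc n)) (i : Fin n) (v : Vector Carrier (suc n)) (j : Fin (suc n)) →
    minor (replaceRow M (suc i) v) zero j ≋ replaceRow (minor M zero j) i (v ∘ punchIn j)
  minor-replaceRow M i v j p q with p Fin.≟ i
  ... | yes ≡.refl = reflexive (≡.trans (replaceRow-updates M (suc p) v (punchIn j q))
          (≡.sym (replaceRow-updates (minor M zero j) p (v ∘ punchIn j) q)))
  ... | no p≢i     = reflexive (≡.trans
          (replaceRow-minimal M v (p≢i ∘ Fin.suc-injective) (punchIn j q))
          (≡.sym (replaceRow-minimal (minor M zero j) (v ∘ punchIn j) p≢i q)))

  -- Jacobi's formula.
  det-proj₂ : (X : D.Mat n) → proj₂ (D.det X) ≈
    ∑ (λ i → ∑ (λ j → proj₂ (X i j) * adjugate (mapMatrix proj₁ X) j i))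
  det-proj₂ {zero}  X = sym (∑-zero λ ())
  det-proj₂ {suc n} X = begin
    proj₂ (D.det X)
      ≈⟨ trans (proj₂ (D.det-suc X)) (∑-proj₂ _) ⟩
    ∑ (λ j → proj₂ (D.sign (toℕ j) D.* (X zero j D.* D.det (D.minor X zero j))))
      ≈⟨ ∑-cong (λ j → trans (proj₂ (D.*-congʳ (sign-ι (toℕ j)))) (expand j)) ⟩
    ∑ (λ j → N zero j * adjugate M j zero + sign (toℕ j) * (M zero j * ∑ (λ i → deriv j i)))
      ≈⟨ ∑-+ _ _ ⟩
    ∑ (λ j → N zero j * adjugate M j zero) +
    ∑ (λ j → sign (toℕ j) * (M zero j * ∑ (λ i → deriv j i)))
      -- The Leibniz terms are regrouped by the differentiated row i instead of the deleted column
      -- j.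
      ≈⟨ +-congˡ (trans (∑-cong λ j → *-*-∑ (sign (toℕ j)) (M zero j) (deriv j))
                        (trans (∑-exchange _) (∑-cong lowerRow))) ⟩
    ∑ (λ j → N zero j * adjugate M j zero) +
    ∑ (λ i → ∑ (λ j → N (suc i) j * adjugate M j (suc i)))
      ≈⟨ ∑-suc _ ⟨
    ∑ (λ i → ∑ (λ j → N i j * adjugate M j i)) ∎
    where
    M N : Mat (suc n)
    M = mapMatrix proj₁ X
    N = mapMatrix proj₂ X
    deriv : Fin (suc n) → Fin n → Carrier
    deriv j i = ∑ (λ l → N (suc i) (punchIn j l) * adjugate (minor M zero j) l i)
    expand : ∀ j → proj₂ (ι (sign (toℕ j)) D.* (X zero j D.* D.det (D.minor X zero j))) ≈
             N zero j * adjugate M j zero + sign (toℕ j) * (M zero j * ∑ (λ i → deriv j i))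
    expand j = begin
      sign (toℕ j) * (M zero j * proj₂ d + N zero j * proj₁ d) + 0# * (M zero j * proj₁ d)
        ≈⟨ trans (+-congˡ (zeroˡ _)) (+-identityʳ _) ⟩
      sign (toℕ j) * (M zero j * proj₂ d + N zero j * proj₁ d)
        ≈⟨ *-congˡ (+-cong (*-congˡ (det-proj₂ (D.minor X zero j)))
                           (*-congˡ (det-proj₁ (D.minor X zero j)))) ⟩
      sign (toℕ j) * (M zero j * ∑ (λ i → deriv j i) + N zero j * det (minor M zero j))
        ≈⟨ solve 5 (λ s x y z w → s :* (x :* y :+ z :* w) := z :* (s :* w) :+ s :* (x :* y))
             refl _ _ _ _ _ ⟩
      N zero j * (sign (toℕ j) * det (minor M zero j)) + sign (toℕ j) * (M zero j * ∑ (λ i → deriv j i))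
        ≈⟨ +-congʳ (*-congˡ (*-congʳ (reflexive (≡.cong sign (≡.sym (ℕ.+-identityʳ (toℕ j))))))) ⟩
      N zero j * adjugate M j zero + sign (toℕ j) * (M zero j * ∑ (λ i → deriv j i)) ∎
      where d = D.det (D.minor X zero j)
    -- Over all j, these terms form the first-row expansion of `M` with row i + 1 replaced by its
    -- ε-part.
    lowerRow : ∀ i → ∑ (λ j → sign (toℕ j) * (M zero j * deriv j i)) ≈
               ∑ (λ j → N (suc i) j * adjugate M j (suc i))
    lowerRow i = begin
      ∑ (λ j → sign (toℕ j) * (M zero j * deriv j i))
        ≈⟨ ∑-cong (λ j → *-congˡ (*-congˡ (trans
             (det-cong (minor-replaceRow M i (N (suc i)) j))
             (det-replaceRow (minor M zero j) i (N (suc i) ∘ punchIn j))))) ⟨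
      ∑ (λ j → sign (toℕ j) * (M zero j * det (minor (replaceRow M (suc i) (N (suc i))) zero j)))
        ≈⟨ det-suc (replaceRow M (suc i) (N (suc i))) ⟨
      det (replaceRow M (suc i) (N (suc i)))
        ≈⟨ det-replaceRow M (suc i) (N (suc i)) ⟩
      ∑ (λ j → N (suc i) j * adjugate M j (suc i)) ∎

-- Pigeonhole principle, matrix algebra and change of basis

-- A missed value could be punched out of the codomain, leaving an injection into a smaller finite
-- set.
injective⇒surjective : {f : Fin n → Fin n} → Injective _≡_ _≡_ f → ∀ k → ∃[ i ] f i ≡ k
injective⇒surjective {suc n} {f} inj k with Fin.any? (λ i → f i Fin.≟ k)
... | yes hit = hit
... | no miss = contradiction (Fin.injective⇒≤ squeeze-injective) ℕ.1+n≰n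
  where
  k≢f : ∀ i → k ≢ f i
  k≢f i k≡fi = miss (i , ≡.sym k≡fi)
  squeeze-injective : Injective _≡_ _≡_ (λ i → punchOut (k≢f i))
  squeeze-injective eq = inj (Fin.punchOut-injective (k≢f _) (k≢f _) eq)

module MatrixAlgebra (R : CommutativeRing a ℓ) where
  open CommutativeRing R hiding (zero)
  open MatrixOps rawRing
  open Determinant R

  matrixSetoid : ℕ → Setoid a ℓ
  matrixSetoid n = record
    { Carrier       = Mat n
    ; _≈_           = _≋_
    ; isEquivalence = record
      { refl  = λ i j → refl
      ; sym   = λ M≋N i j → sym (M≋N i j)
      ; trans = λ M≋N N≋P i j → trans (M≋N i j) (N≋P i j)
      }
    }

  ·-cong : {M M′ N N′ : Mat n} → M ≋ M′ → N ≋ N′ → M · N ≋ M′ · N′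
  ·-cong {M = M} {M′} {N} {N′} M≋M′ N≋N′ i k = trans (·-∑ M N i k) (trans
    (∑-cong λ j → *-cong (M≋M′ i j) (N≋N′ j k)) (sym (·-∑ M′ N′ i k)))

  ·-congˡ : (M : Mat n) {N N′ : Mat n} → N ≋ N′ → M · N ≋ M · N′
  ·-congˡ M = ·-cong (λ _ _ → refl)

  ·-congʳ : (N : Mat n) {M M′ : Mat n} → M ≋ M′ → M · N ≋ M′ · N
  ·-congʳ N M≋M′ = ·-cong M≋M′ (λ _ _ → refl)

  ·-assoc : (M N P : Mat n) → (M · N) · P ≋ M · (N · P)
  ·-assoc M N P i l = begin
    ((M · N) · P) i l
      ≈⟨ ·-∑ (M · N) P i l ⟩
    ∑ (λ k → (M · N) i k * P k l)
      ≈⟨ ∑-cong (λ k → trans (*-congʳ (·-∑ M N i k)) (*-∑ʳ (P k l) _)) ⟩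
    ∑ (λ k → ∑ (λ j → M i j * N j k * P k l))
      ≈⟨ ∑-exchange _ ⟩
    ∑ (λ j → ∑ (λ k → M i j * N j k * P k l))
      ≈⟨ ∑-cong (λ j → trans (∑-cong λ k → *-assoc _ _ _) (sym (*-∑ˡ (M i j) _))) ⟩
    ∑ (λ j → M i j * ∑ (λ k → N j k * P k l))
      ≈⟨ ∑-cong (λ j → *-congˡ (·-∑ N P j l)) ⟨
    ∑ (λ j → M i j * (N · P) j l)
      ≈⟨ ·-∑ M (N · P) i l ⟨
    (M · (N · P)) i l ∎
    where open Relation.Binary.Reasoning.Setoid setoid

  ·-identityˡ : (M : Mat n) → identity · M ≋ M
  ·-identityˡ M i k = trans (·-∑ identity M i k) (∑-identity i (λ j → M j k))

  transpose-· : (M N : Mat n) → transpose (M · N) ≋ transpose N · transpose M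
  transpose-· M N i k = trans (·-∑ M N k i) (trans
    (∑-cong λ j → *-comm _ _) (sym (·-∑ (transpose N) (transpose M) i k)))

  identity-symmetric : IsSymmetric (identity {n})
  identity-symmetric i j with i Fin.≟ j
  ... | yes ≡.refl = sym (identity-diagonal i)
  ... | no i≢j     = sym (identity-off (i≢j ∘ ≡.sym))

  ·-identityʳ : (M : Mat n) → M · identity ≋ M
  ·-identityʳ M i k = trans (transpose-· M identity k i) (trans
    (·-congʳ (transpose M) (λ p q → identity-symmetric q p) k i)
    (·-identityˡ (transpose M) k i))

  left-inverse≈right-inverse : {U X Y : Mat n} → X · U ≋ identity → U · Y ≋ identity → X ≋ Y
  left-inverse≈right-inverse {U = U} {X} {Y} XU≋1 UY≋1 = begin
    X              ≈⟨ ·-identityʳ X ⟨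
    X · identity   ≈⟨ ·-congˡ X UY≋1 ⟨
    X · (U · Y)    ≈⟨ ·-assoc X U Y ⟨
    (X · U) · Y    ≈⟨ ·-congʳ Y XU≋1 ⟩
    identity · Y   ≈⟨ ·-identityˡ Y ⟩
    Y              ∎
    where open Relation.Binary.Reasoning.Setoid (matrixSetoid _)

  diagonal-· : {D : Mat n} → IsDiagonal D → (M : Mat n) → ∀ i k → (D · M) i k ≈ D i i * M i k
  diagonal-· {D = D} D-diag M i k = trans (·-∑ D M i k)
    (∑-single i λ j j≢i → trans (*-congʳ (D-diag i j (j≢i ∘ ≡.sym))) (zeroˡ _))

  ·-diagonal : {D : Mat n} → IsDiagonal D → (M : Mat n) → ∀ i k → (M · D) i k ≈ M i k * D k k
  ·-diagonal {D = D} D-diag M i k = trans (·-∑ M D i k)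
    (∑-single k λ j j≢k → trans (*-congˡ (D-diag j k j≢k)) (zeroʳ _))

  gram : Mat n → Mat n → Mat n
  gram U A = transpose U · A · U

  gram-symmetric : (U : Mat n) {A : Mat n} → IsSymmetric A → IsSymmetric (gram U A)
  gram-symmetric U {A} A-sym i j = sym (begin
    gram U A j i
      ≈⟨ transpose-· (transpose U · A) U i j ⟩
    (transpose U · transpose (transpose U · A)) i j
      ≈⟨ ·-congˡ (transpose U) (transpose-· (transpose U) A) i j ⟩
    (transpose U · (transpose A · U)) i j
      ≈⟨ ·-congˡ (transpose U) (·-congʳ U λ p q → A-sym q p) i j ⟩
    (transpose U · (A · U)) i j
      ≈⟨ ·-assoc (transpose U) A U i j ⟨
    gram U A i j ∎)
    where open Relation.Binary.Reasoning.Setoid setoid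

  module ChangeOfBasis {U Y V W : Mat n}
    (UY≋1 : U · Y ≋ identity) (YU≋1 : Y · U ≋ identity)
    (WV≋1 : W · V ≋ identity) (VW≋1 : V · W ≋ identity) where
    open Relation.Binary.Reasoning.Setoid (matrixSetoid n)

    -- The columns of `C` are the coordinates of those of `V` in the basis `U`; `E` is the
    -- transposed inverse of `C`.
    C E : Mat n
    C = Y · V
    E = transpose (W · U)

    V≋UC : V ≋ U · C
    V≋UC = begin
      V             ≈⟨ ·-identityˡ V ⟨
      identity · V  ≈⟨ ·-congʳ V UY≋1 ⟨
      (U · Y) · V   ≈⟨ ·-assoc U Y V ⟩
      U · C         ∎

    WUC≋1 : (W · U) · C ≋ identity
    WUC≋1 = begin
      (W · U) · C   ≈⟨ ·-assoc W U C ⟩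
      W · (U · C)   ≈⟨ ·-congˡ W V≋UC ⟨
      W · V         ≈⟨ WV≋1 ⟩
      identity      ∎

    VWU≋U : V · (W · U) ≋ U
    VWU≋U = begin
      V · (W · U)   ≈⟨ ·-assoc V W U ⟨
      (V · W) · U   ≈⟨ ·-congʳ U VW≋1 ⟩
      identity · U  ≈⟨ ·-identityˡ U ⟩
      U             ∎

    CWU≋1 : C · (W · U) ≋ identity
    CWU≋1 = begin
      C · (W · U)        ≈⟨ ·-assoc Y V (W · U) ⟩
      Y · (V · (W · U))  ≈⟨ ·-congˡ Y VWU≋U ⟩
      Y · U              ≈⟨ YU≋1 ⟩
      identity           ∎

    U^T≋EV^T : transpose U ≋ E · transpose V
    U^T≋EV^T = begin
      transpose U              ≈⟨ (λ i j → sym (VWU≋U j i)) ⟩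
      transpose (V · (W · U))  ≈⟨ transpose-· V (W · U) ⟩
      E · transpose V          ∎

    -- Both sides equal UᵗXV: on the left `V` is expressed through `U`, on the right `U` through
    -- `V`.
    intertwine : (X : Mat n) → gram U X · C ≋ E · gram V X
    intertwine X = begin
      gram U X · C                     ≈⟨ ·-assoc (transpose U · X) U C ⟩
      transpose U · X · (U · C)        ≈⟨ ·-congˡ (transpose U · X) V≋UC ⟨
      transpose U · X · V              ≈⟨ ·-assoc (transpose U) X V ⟩
      transpose U · (X · V)            ≈⟨ ·-congʳ (X · V) U^T≋EV^T ⟩
      (E · transpose V) · (X · V)      ≈⟨ ·-assoc E (transpose V) (X · V) ⟩
      E · (transpose V · (X · V))      ≈⟨ ·-congˡ E (·-assoc (transpose V) X V) ⟨
      E · gram V X                     ∎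

-- Apartness in Heyting fields and two-sided inverses

module Field (L : HeytingField a ℓ r) where
  open HeytingField L using (_#_; heytingCommutativeRing; #⇒invertible; #-irrefl; #-cotrans; tight)
  R : CommutativeRing a ℓ
  R = HeytingCommutativeRing.commutativeRing heytingCommutativeRing
  open CommutativeRing R hiding (zero)
  open Algebra.Apartness.Properties.HeytingCommutativeRing heytingCommutativeRing public
    using (1#0; x#0y#0→xy#0; #-congʳ)
  open Algebra.Apartness.Properties.HeytingCommutativeRing heytingCommutativeRing
    using (x-0≈x; invertibleˡ⇒#)
  open MatrixOps rawRing
  open Algebra.Definitions.RawSemiring (RawRing.rawSemiring rawRing) using (product)
  open Determinant R
  open MatrixAlgebra R
  open IntegerCoefficients R
  open Relation.Binary.Reasoning.Setoid setoid

  private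
    variable
      x y : Carrier

  #0⇒inverse : x # 0# → ∃[ y ] y * x ≈ 1#
  #0⇒inverse x#0 with y , yx≈1 , _ ← #⇒invertible x#0 =
    y , trans (*-congˡ (sym (x-0≈x _))) yx≈1

  inverse⇒#0 : y * x ≈ 1# → x # 0#
  inverse⇒#0 {y} yx≈1 = invertibleˡ⇒# (y , trans (*-congˡ (x-0≈x _)) yx≈1)

  *-#0ʳ : ∀ x y → x * y # 0# → y # 0#
  *-#0ʳ x y xy#0 with z , zxy≈1 ← #0⇒inverse xy#0 = inverse⇒#0 (trans (*-assoc z x y) zxy≈1)

  *-#0ˡ : ∀ x y → x * y # 0# → x # 0#
  *-#0ˡ x y xy#0 = *-#0ʳ y x (#-congʳ (*-comm x y) xy#0)

  -‿#0 : x # 0# → - x # 0#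
  -‿#0 {x} x#0 = *-#0ˡ (- x) (- x) (#-congʳ
    (solve 1 (λ x → x :* x := (:- x) :* (:- x)) refl x) (x#0y#0→xy#0 x#0 x#0))

  -- Cotransitivity compares x + y and 0 with y; if x + y is apart from y, then x is invertible.
  +-#0 : ∀ x y → x + y # 0# → x # 0# ⊎ y # 0#
  +-#0 x y x+y#0 with #-cotrans x+y#0 y
  ... | inj₂ y#0   = inj₂ y#0
  ... | inj₁ x+y#y with z , zx≈1 , _ ← #⇒invertible x+y#y = inj₁ (inverse⇒#0 (trans
    (*-congˡ (trans (sym (+-identityʳ x)) (trans (+-congˡ (sym (-‿inverseʳ y))) (sym (+-assoc x y (- y))))))
    zx≈1))

  -- The only source of indices in the proof: a nonzero entry is never searched for, but extracted
  -- from a sum apart from zero.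
  ∑-#0 : (f : Vector Carrier n) → ∑ f # 0# → ∃[ i ] f i # 0#
  ∑-#0 {zero}  f ∑f#0 = contradiction ∑f#0 (#-irrefl (∑-zero λ ()))
  ∑-#0 {suc n} f ∑f#0 with +-#0 (f zero) (∑ (f ∘ suc)) (#-congʳ (∑-suc f) ∑f#0)
  ... | inj₁ f₀#0 = zero , f₀#0
  ... | inj₂ ∑f#0 with i , fᵢ#0 ← ∑-#0 (f ∘ suc) ∑f#0 = suc i , fᵢ#0

  product-#0⁻ : (f : Vector Carrier n) → product f # 0# → ∀ i → f i # 0#
  product-#0⁻ f ∏f#0 zero    = *-#0ˡ _ _ ∏f#0
  product-#0⁻ f ∏f#0 (suc i) = product-#0⁻ (f ∘ suc) (*-#0ʳ _ _ ∏f#0) i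

  product-#0⁺ : (f : Vector Carrier n) → (∀ i → f i # 0#) → product f # 0#
  product-#0⁺ {zero}  f f#0 = 1#0
  product-#0⁺ {suc n} f f#0 = x#0y#0→xy#0 (f#0 zero) (product-#0⁺ (f ∘ suc) (f#0 ∘ suc))

  -- Apartness is tight, so refuting `y # 0#` is enough.
  *-zero-cancelˡ : x # 0# → x * y ≈ 0# → y ≈ 0#
  *-zero-cancelˡ {x} {y} x#0 xy≈0 = proj₁ (tight y 0#) λ y#0 →
    #-irrefl xy≈0 (x#0y#0→xy#0 x#0 y#0)

  -- Steinitz exchange: each row of the identity is a combination of the rows
  -- of U, so it can be traded for one of them while the determinant stays
  -- apart from zero.
  module _ {U Y : Mat n} (YU≋1 : Y · U ≋ identity) where
    exchangeRow : (Z : Mat n) (k : Fin n) → (∀ j → Z k j ≈ identity k j) → det Z # 0# →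
                  ∃[ l ] det (replaceRow Z k (U l)) # 0#
    exchangeRow Z k Zₖ≈eₖ detZ#0 =
      let l , term#0 = ∑-#0 _ (#-congʳ expansion detZ#0) in l , *-#0ʳ (Y k l) _ term#0
      where
      expansion : det Z ≈ ∑ (λ l → Y k l * det (replaceRow Z k (U l)))
      expansion = begin
        det Z
          ≈⟨ trans (sym (·-adjugate-diagonal Z k)) (·-∑ Z (adjugate Z) k k) ⟩
        ∑ (λ j → Z k j * adjugate Z j k)
          ≈⟨ ∑-cong (λ j → *-congʳ (trans (Zₖ≈eₖ j) (trans (sym (YU≋1 k j)) (·-∑ Y U k j)))) ⟩
        ∑ (λ j → ∑ (λ l → Y k l * U l j) * adjugate Z j k)
          ≈⟨ ∑-cong (λ j → *-∑ʳ (adjugate Z j k) _) ⟩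
        ∑ (λ j → ∑ (λ l → Y k l * U l j * adjugate Z j k))
          ≈⟨ ∑-exchange _ ⟩
        ∑ (λ l → ∑ (λ j → Y k l * U l j * adjugate Z j k))
          ≈⟨ ∑-cong (λ l → trans (∑-cong λ j → *-assoc _ _ _) (sym (*-∑ˡ (Y k l) _))) ⟩
        ∑ (λ l → Y k l * ∑ (λ j → U l j * adjugate Z j k))
          ≈⟨ ∑-cong (λ l → *-congˡ (det-replaceRow Z k (U l))) ⟨
        ∑ (λ l → Y k l * det (replaceRow Z k (U l))) ∎

    -- The state after m trades. Rows from m on are still those of the identity, as `exchangeRow`
    -- demands for the next trade.
    record PartialExchange (m : ℕ) : Set (a ⊔ ℓ ⊔ r) where
      field
        Z         : Mat n
        det-#0    : det Z # 0#
        exchanged : ∀ i → toℕ i ℕ.< m → ∃[ l ] (∀ j → Z i j ≈ U l j)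
        untouched : ∀ i → m ℕ.≤ toℕ i → ∀ j → Z i j ≈ identity i j

    exchangeRows : ∀ m → m ℕ.≤ n → PartialExchange m
    exchangeRows zero    _   = record
      { Z         = identity
      ; det-#0    = #-congʳ (sym (det-identity n)) 1#0
      ; exchanged = λ i ()
      ; untouched = λ i _ j → refl
      }
    exchangeRows (suc m) m<n = record
      { Z         = replaceRow Z k (U l)
      ; det-#0    = det′-#0
      ; exchanged = exchanged′
      ; untouched = λ i m<i j → trans
          (reflexive (replaceRow-minimal Z (U l) (λ { ≡.refl → ℕ.<-irrefl (≡.sym toℕk≡m) m<i }) j))
          (untouched i (ℕ.<⇒≤ m<i) j)
      }
      where
      open PartialExchange (exchangeRows m (ℕ.<⇒≤ m<n))
      k : Fin n
      k = fromℕ< m<n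
      toℕk≡m : toℕ k ≡ m
      toℕk≡m = Fin.toℕ-fromℕ< m<n
      exchange = exchangeRow Z k (untouched k (ℕ.≤-reflexive (≡.sym toℕk≡m))) det-#0
      l = proj₁ exchange
      det′-#0 = proj₂ exchange
      exchanged′ : ∀ i → toℕ i ℕ.< suc m → ∃[ l′ ] (∀ j → replaceRow Z k (U l) i j ≈ U l′ j)
      exchanged′ i i<1+m with i Fin.≟ k
      ... | yes ≡.refl = l , λ j → reflexive (replaceRow-updates Z k (U l) j)
      ... | no i≢k     =
        let l′ , Zᵢ≈Uₗ = exchanged i (ℕ.≤∧≢⇒< (ℕ.s≤s⁻¹ i<1+m)
              (λ toℕi≡m → i≢k (Fin.toℕ-injective (≡.trans toℕi≡m (≡.sym toℕk≡m)))))
        in l′ , λ j → trans (reflexive (replaceRow-minimal Z (U l) i≢k j)) (Zᵢ≈Uₗ j)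

    -- After n trades every row of `Z` is a row of `U`, and no row is used twice since det Z is
    -- apart from zero. So `Z` is `U` with its rows permuted, and its adjugate yields a right
    -- inverse of `U`, which must equal `Y`.
    left-inverse⇒right-inverse : U · Y ≋ identity
    left-inverse⇒right-inverse = λ i j → trans
      (·-congˡ U (left-inverse≈right-inverse {U = U} {Y} {X} YU≋1 UX≋1) i j) (UX≋1 i j)
      where
      open PartialExchange (exchangeRows n ℕ.≤-refl)
      ρ : Fin n → Fin n
      ρ i = proj₁ (exchanged i (Fin.toℕ<n i))
      Z≈U : ∀ i j → Z i j ≈ U (ρ i) j
      Z≈U i = proj₂ (exchanged i (Fin.toℕ<n i))
      ρ-injective : Injective _≡_ _≡_ ρ
      ρ-injective {i} {j} ρi≡ρj with i Fin.≟ j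
      ... | yes i≡j = i≡j
      ... | no i≢j  = contradiction det-#0 (#-irrefl (det-equal-rows Z i≢j λ q → trans
        (Z≈U i q) (trans (reflexive (≡.cong (λ l → U l q) ρi≡ρj)) (sym (Z≈U j q)))))
      σ : Fin n → Fin n
      σ l = proj₁ (injective⇒surjective ρ-injective l)
      ρσ : ∀ l → ρ (σ l) ≡ l
      ρσ l = proj₂ (injective⇒surjective ρ-injective l)
      d⁻¹ : Carrier
      d⁻¹ = proj₁ (#0⇒inverse det-#0)
      -- Row l of `U` is row `σ l` of `Z`, so the columns of the inverse of `Z` are permuted by `σ`.
      X : Mat n
      X j l = adjugate Z j (σ l) * d⁻¹
      UX≈Z·adj : ∀ l m → (U · X) l m ≈ (Z · adjugate Z) (σ l) (σ m) * d⁻¹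
      UX≈Z·adj l m = begin
        (U · X) l m
          ≈⟨ ·-∑ U X l m ⟩
        ∑ (λ j → U l j * (adjugate Z j (σ m) * d⁻¹))
          ≈⟨ ∑-cong (λ j → trans (*-congʳ (trans
               (reflexive (≡.cong (λ l → U l j) (≡.sym (ρσ l)))) (sym (Z≈U (σ l) j))))
               (sym (*-assoc _ _ _))) ⟩
        ∑ (λ j → Z (σ l) j * adjugate Z j (σ m) * d⁻¹)
          ≈⟨ trans (*-congʳ (·-∑ Z (adjugate Z) (σ l) (σ m))) (*-∑ʳ d⁻¹ _) ⟨
        (Z · adjugate Z) (σ l) (σ m) * d⁻¹ ∎
      UX≋1 : U · X ≋ identity
      UX≋1 l m with l Fin.≟ m
      ... | yes ≡.refl = begin
        (U · X) l l                          ≈⟨ UX≈Z·adj l l ⟩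
        (Z · adjugate Z) (σ l) (σ l) * d⁻¹   ≈⟨ *-congʳ (·-adjugate-diagonal Z (σ l)) ⟩
        det Z * d⁻¹                          ≈⟨ *-comm _ _ ⟩
        d⁻¹ * det Z                          ≈⟨ proj₂ (#0⇒inverse det-#0) ⟩
        1#                                   ∎
      ... | no l≢m = begin
        (U · X) l m                          ≈⟨ UX≈Z·adj l m ⟩
        (Z · adjugate Z) (σ l) (σ m) * d⁻¹   ≈⟨ *-congʳ (·-adjugate-off Z λ σl≡σm →
                                                  l≢m (≡.trans (≡.sym (ρσ l)) (≡.trans (≡.cong ρ σl≡σm) (ρσ m)))) ⟩
        0# * d⁻¹                             ≈⟨ zeroˡ d⁻¹ ⟩
        0#                                   ∎

-- Matrix pencils, simple zeros and monomial matrices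

module Pencils (L : HeytingField a ℓ r) where
  open Field L
  open CommutativeRing R hiding (zero)
  open HeytingField L using (_#_; #-irrefl)
  open Diagonalization L hiding (Carrier; _≈_; _#_; _+_; _*_; -_; 0#; 1#)
  open Algebra.Definitions.RawSemiring (RawRing.rawSemiring rawRing) using (product; _^_)
  open Determinant R
  open MatrixAlgebra R
  open IntegerCoefficients R
  open Algebra.Properties.Ring ring using (x∙y⁻¹≈ε⇒x≈y)
  open DualNumbers R
  open Relation.Binary.Reasoning.Setoid setoid

  private
    module D where
      open CommutativeRing dualNumbers public
      open MatrixOps (CommutativeRing.rawRing dualNumbers) public
      open Algebra.Definitions.RawSemiring
        (RawRing.rawSemiring (CommutativeRing.rawRing dualNumbers)) public using (product)

  square-#0 : ∀ {p} {Q : Set p} (Q? : Dec Q) → Q → ∀ x →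
              (if does Q? then x ^ 2 else 1#) # 0# → x # 0#
  square-#0 Q? q x factor#0 = *-#0ˡ x (x ^ 1) (#-congʳ
    (reflexive (≡.cong (λ b → if b then x ^ 2 else 1#) (dec-true Q? q))) factor#0)

  discriminant-#0 : {s t : Vector Carrier n} → discriminant rawRing s t # 0# →
                    ∀ {i j} → i ≢ j → s i * t j - s j * t i # 0#
  discriminant-#0 {s = s} {t} disc#0 {i} {j} i≢j with Fin.<-cmp i j
  ... | tri≈ _ i≡j _ = contradiction i≡j i≢j
  ... | tri< i<j _ _ = square-#0 (i Fin.<? j) i<j _ (product-#0⁻ _ (product-#0⁻ _ disc#0 i) j)
  ... | tri> _ _ j<i = #-congʳ
        (solve 4 (λ si tj sj ti → :- (sj :* ti :- si :* tj) := si :* tj :- sj :* ti)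
          refl (s i) (t j) (s j) (t i))
        (-‿#0 (square-#0 (j Fin.<? i) j<i _ (product-#0⁻ _ (product-#0⁻ _ disc#0 j) i)))

  product-proj₁ : (f : Vector D.Carrier n) → proj₁ (D.product f) ≈ product (proj₁ ∘ f)
  product-proj₁ = RingHomomorphism.product-homo D.rawRing R proj₁-isRingHomomorphism

  -- By the Leibniz rule, only the summand that differentiates the vanishing factor survives in the
  -- ε-part, and all its factors are apart from zero.
  product-simple-zero : (f : Vector D.Carrier n) (i : Fin n) →
    proj₁ (f i) ≈ 0# → proj₂ (f i) # 0# → (∀ k → k ≢ i → proj₁ (f k) # 0#) →
    proj₁ (D.product f) ≈ 0# × proj₂ (D.product f) # 0#
  product-simple-zero f zero fᵢ≈0 fᵢ′#0 f#0 =
    trans (*-congʳ fᵢ≈0) (zeroˡ _) ,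
    #-congʳ (sym (trans (+-congʳ (trans (*-congʳ fᵢ≈0) (zeroˡ _))) (+-identityˡ _)))
      (x#0y#0→xy#0 fᵢ′#0 (#-congʳ (sym (product-proj₁ (f ∘ suc)))
        (product-#0⁺ _ λ k → f#0 (suc k) λ ())))
  product-simple-zero f (suc i) fᵢ≈0 fᵢ′#0 f#0
    with p≈0 , p′#0 ← product-simple-zero (f ∘ suc) i fᵢ≈0 fᵢ′#0 (λ k k≢i → f#0 (suc k) (k≢i ∘ Fin.suc-injective)) =
    trans (*-congˡ p≈0) (zeroʳ _) ,
    #-congʳ (sym (trans (+-congˡ (trans (*-congˡ p≈0) (zeroʳ _))) (+-identityʳ _)))
      (x#0y#0→xy#0 (f#0 zero λ ()) p′#0)

  pencilAt-·ʳ : (A B U : Mat n) (s t : Carrier) → pencilAt A B s t · U ≋ pencilAt (A · U) (B · U) s t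
  pencilAt-·ʳ A B U s t i k = begin
    (pencilAt A B s t · U) i k
      ≈⟨ ·-∑ (pencilAt A B s t) U i k ⟩
    ∑ (λ j → (t * A i j - s * B i j) * U j k)
      ≈⟨ ∑-cong (λ j → solve 5 (λ t a s b u → (t :* a :- s :* b) :* u := t :* (a :* u) :+ (:- s) :* (b :* u))
           refl _ _ _ _ _) ⟩
    ∑ (λ j → t * (A i j * U j k) + - s * (B i j * U j k))
      ≈⟨ ∑-+ _ _ ⟩
    ∑ (λ j → t * (A i j * U j k)) + ∑ (λ j → - s * (B i j * U j k))
      ≈⟨ +-cong (*-∑ˡ t _) (*-∑ˡ (- s) _) ⟨
    t * ∑ (λ j → A i j * U j k) + - s * ∑ (λ j → B i j * U j k)
      ≈⟨ +-cong (*-congˡ (·-∑ A U i k)) (*-congˡ (·-∑ B U i k)) ⟨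
    t * (A · U) i k + - s * (B · U) i k
      ≈⟨ solve 4 (λ t x s y → t :* x :+ (:- s) :* y := t :* x :- s :* y) refl _ _ _ _ ⟩
    t * (A · U) i k - s * (B · U) i k ∎

  pencilAt-cong : {A A′ B B′ : Mat n} (s t : Carrier) → A ≋ A′ → B ≋ B′ →
                  pencilAt A B s t ≋ pencilAt A′ B′ s t
  pencilAt-cong s t A≋A′ B≋B′ i j = +-cong (*-congˡ (A≋A′ i j)) (-‿cong (*-congˡ (B≋B′ i j)))

  pencilAt-·ˡ : (W A B : Mat n) (s t : Carrier) → W · pencilAt A B s t ≋ pencilAt (W · A) (W · B) s t
  pencilAt-·ˡ W A B s t i k = begin
    (W · pencilAt A B s t) i k
      ≈⟨ transpose-· W (pencilAt A B s t) k i ⟩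
    (pencilAt (transpose A) (transpose B) s t · transpose W) k i
      ≈⟨ pencilAt-·ʳ (transpose A) (transpose B) (transpose W) s t k i ⟩
    pencilAt (transpose A · transpose W) (transpose B · transpose W) s t k i
      ≈⟨ pencilAt-cong s t (λ p q → sym (transpose-· W A p q)) (λ p q → sym (transpose-· W B p q)) k i ⟩
    pencilAt (W · A) (W · B) s t i k ∎

  gram-pencilAt : (U A B : Mat n) (s t : Carrier) →
                  gram U (pencilAt A B s t) ≋ pencilAt (gram U A) (gram U B) s t
  gram-pencilAt U A B s t i j = trans
    (·-congʳ U (pencilAt-·ˡ (transpose U) A B s t) i j)
    (pencilAt-·ʳ (transpose U · A) (transpose U · B) U s t i j)

  -- A diagonal entry of the product is 1, hence one of its summands is apart from zero.
  inverse-support : (X Z : Mat n) → X · Z ≋ identity → ∀ k → ∃[ i ] X k i * Z i k # 0#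
  inverse-support X Z XZ≋1 k = ∑-#0 _ (#-congʳ
    (trans (sym (trans (XZ≋1 k k) (identity-diagonal k))) (·-∑ X Z k k)) 1#0)

  -- The row chosen in column k defines `σ`, the column chosen in row i defines `τ`. Uniqueness
  -- within a column forces `σ (τ i) ≡ i`.
  monomial⇒SameColumns : {U V C : Mat n} → V ≋ U · C →
    (∀ {i j k} → i ≢ j → C i k # 0# → C j k ≈ 0#) →
    (∀ k → ∃[ i ] C i k # 0#) → (∀ i → ∃[ k ] C i k # 0#) → SameColumns V U
  monomial⇒SameColumns {n} {U} {V} {C} V≋UC one-per-column column-support row-support =
    permutation σ τ στ τσ , (λ k → C (σ k) k) , C-#0 , V≈
    where
    σ τ : Fin n → Fin n
    σ k = proj₁ (column-support k)
    τ i = proj₁ (row-support i)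

    C-#0 : ∀ k → C (σ k) k # 0#
    C-#0 k = proj₂ (column-support k)

    στ : ∀ i → σ (τ i) ≡ i
    στ i with σ (τ i) Fin.≟ i
    ... | yes στi≡i = στi≡i
    ... | no στi≢i  = contradiction (proj₂ (row-support i)) (#-irrefl (one-per-column στi≢i (C-#0 (τ i))))

    τ-injective : Injective _≡_ _≡_ τ
    τ-injective {i} {j} τi≡τj = ≡.trans (≡.sym (στ i)) (≡.trans (≡.cong σ τi≡τj) (στ j))

    -- Uniqueness is known within columns only, so this side comes from counting: the injective `τ`
    -- is onto.
    τσ : ∀ k → τ (σ k) ≡ k
    τσ k with i , ≡.refl ← injective⇒surjective τ-injective k = ≡.cong τ (στ i)

    V≈ : ∀ i k → V i k ≈ C (σ k) k * U i (σ k)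
    V≈ i k = begin
      V i k                        ≈⟨ V≋UC i k ⟩
      (U · C) i k                  ≈⟨ ·-∑ U C i k ⟩
      ∑ (λ l → U i l * C l k)      ≈⟨ ∑-single (σ k) (λ l l≢σk → trans
                                        (*-congˡ (one-per-column (l≢σk ∘ ≡.sym) (C-#0 k))) (zeroʳ _)) ⟩
      U i (σ k) * C (σ k) k        ≈⟨ *-comm _ _ ⟩
      C (σ k) k * U i (σ k)        ∎

  -- Diagonalization by kernel vectors, and its uniqueness

  module Eigenvectors
    (A B : Mat n) (A-symmetric : IsSymmetric A) (B-symmetric : IsSymmetric B)
    (s t : Vector Carrier n)
    (distinct : ∀ {i j} → i ≢ j → s i * t j - s j * t i # 0#)
    (other : (i : Fin n) → ∃[ j ] i ≢ j)
    (U : Mat n)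
    (M-kernel : ∀ i k → (pencilAt A B (s i) (t i) · U) k i ≈ 0#)
    (M-nondegenerate : ∀ {i j} → i ≢ j → gram U (pencilAt A B (s j) (t j)) i i # 0#)
    where

    M : Fin n → Mat n
    M i = pencilAt A B (s i) (t i)

    α β : Mat n
    α = gram U A
    β = gram U B

    gram-M : ∀ i → gram U (M i) ≋ pencilAt α β (s i) (t i)
    gram-M i = gram-pencilAt U A B (s i) (t i)

    -- `M i` kills column i of `U`, so column i of `gram U (M i)` vanishes.
    tα≈sβ : ∀ i j → t i * α j i ≈ s i * β j i
    tα≈sβ i j = x∙y⁻¹≈ε⇒x≈y _ _ (begin
      pencilAt α β (s i) (t i) j i        ≈⟨ gram-M i j i ⟨
      gram U (M i) j i                    ≈⟨ ·-assoc (transpose U) (M i) U j i ⟩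
      (transpose U · (M i · U)) j i       ≈⟨ ·-∑ (transpose U) (M i · U) j i ⟩
      ∑ (λ k → U k j * (M i · U) k i)     ≈⟨ ∑-zero (λ k → trans (*-congˡ (M-kernel i k)) (zeroʳ _)) ⟩
      0#                                  ∎)

    tα≈sβ′ : ∀ i j → t i * α i j ≈ s i * β i j
    tα≈sβ′ i j = trans (*-congˡ (gram-symmetric U A-symmetric i j))
      (trans (tα≈sβ i j) (*-congˡ (gram-symmetric U B-symmetric j i)))

    -- By symmetry, `(α i j , β i j)` solves two homogeneous linear equations, one for root i and
    -- one for root j. Their determinant is the quantity in `distinct`, up to sign.
    α-diagonal : IsDiagonal α
    α-diagonal i j i≢j = *-zero-cancelˡ (distinct i≢j) (begin
      (s i * t j - s j * t i) * α i j
        ≈⟨ solve 5 (λ si tj sj ti x → (si :* tj :- sj :* ti) :* x := si :* (tj :* x) :- sj :* (ti :* x))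
             refl _ _ _ _ _ ⟩
      s i * (t j * α i j) - s j * (t i * α i j)
        ≈⟨ +-cong (*-congˡ (tα≈sβ j i)) (-‿cong (*-congˡ (tα≈sβ′ i j))) ⟩
      s i * (s j * β i j) - s j * (s i * β i j)
        ≈⟨ solve 3 (λ si sj y → si :* (sj :* y) :- sj :* (si :* y) := y :- y) refl _ _ _ ⟩
      β i j - β i j
        ≈⟨ -‿inverseʳ _ ⟩
      0# ∎)

    β-diagonal : IsDiagonal β
    β-diagonal i j i≢j = *-zero-cancelˡ (distinct i≢j) (begin
      (s i * t j - s j * t i) * β i j
        ≈⟨ solve 5 (λ si tj sj ti x → (si :* tj :- sj :* ti) :* x := tj :* (si :* x) :- ti :* (sj :* x))
             refl _ _ _ _ _ ⟩
      t j * (s i * β i j) - t i * (s j * β i j)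
        ≈⟨ +-cong (*-congˡ (tα≈sβ′ i j)) (-‿cong (*-congˡ (tα≈sβ j i))) ⟨
      t j * (t i * α i j) - t i * (t j * α i j)
        ≈⟨ solve 3 (λ ti tj x → tj :* (ti :* x) :- ti :* (tj :* x) := x :- x) refl _ _ _ ⟩
      α i j - α i j
        ≈⟨ -‿inverseʳ _ ⟩
      0# ∎)

    γ-#0 : ∀ {i j} → i ≢ j → t j * α i i - s j * β i i # 0#
    γ-#0 {i} {j} i≢j = #-congʳ (gram-M j i i) (M-nondegenerate i≢j)

    -- For i ≢ j, row i of the diagonal matrix `gram U (M j)` has its only nonzero entry on the
    -- diagonal, by `γ-#0`. Each row takes its own j, as `M j` degenerates on column j of `U`.
    Y : Mat n
    Y i k = proj₁ (#0⇒inverse (γ-#0 (proj₂ (other i)))) * (transpose U · M (proj₁ (other i))) i k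

    YU≋1 : Y · U ≋ identity
    YU≋1 i l = trans YU≈ (g⁻¹*gram (i Fin.≟ l))
      where
      j = proj₁ (other i)
      g⁻¹ = proj₁ (#0⇒inverse (γ-#0 (proj₂ (other i))))
      YU≈ : (Y · U) i l ≈ g⁻¹ * pencilAt α β (s j) (t j) i l
      YU≈ = begin
        (Y · U) i l
          ≈⟨ ·-∑ Y U i l ⟩
        ∑ (λ k → g⁻¹ * (transpose U · M j) i k * U k l)
          ≈⟨ trans (∑-cong λ k → *-assoc _ _ _) (sym (*-∑ˡ g⁻¹ _)) ⟩
        g⁻¹ * ∑ (λ k → (transpose U · M j) i k * U k l)
          ≈⟨ *-congˡ (·-∑ (transpose U · M j) U i l) ⟨
        g⁻¹ * gram U (M j) i l
          ≈⟨ *-congˡ (gram-M j i l) ⟩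
        g⁻¹ * pencilAt α β (s j) (t j) i l ∎
      g⁻¹*gram : Dec (i ≡ l) → g⁻¹ * pencilAt α β (s j) (t j) i l ≈ identity i l
      g⁻¹*gram (yes ≡.refl) = trans (proj₂ (#0⇒inverse (γ-#0 (proj₂ (other i)))))
        (sym (identity-diagonal i))
      g⁻¹*gram (no i≢l) = begin
        g⁻¹ * (t j * α i l - s j * β i l)
          ≈⟨ *-congˡ (+-cong (*-congˡ (α-diagonal i l i≢l)) (-‿cong (*-congˡ (β-diagonal i l i≢l)))) ⟩
        g⁻¹ * (t j * 0# - s j * 0#)
          ≈⟨ *-congˡ (trans (+-cong (zeroʳ (t j)) (-‿cong (zeroʳ (s j)))) (-‿inverseʳ 0#)) ⟩
        g⁻¹ * 0#
          ≈⟨ trans (zeroʳ g⁻¹) (sym (identity-off i≢l)) ⟩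
        identity i l ∎

    UY≋1 : U · Y ≋ identity
    UY≋1 = left-inverse⇒right-inverse {U = U} {Y} YU≋1

    diagonalizes : SimultaneouslyDiagonalizes U A B
    diagonalizes = (Y , YU≋1 , UY≋1) , α-diagonal , β-diagonal

    -- By `tα≈sβ`, the projective points (α i i : β i i) are the (sᵢ : tᵢ), hence distinct. Which
    -- coordinate of `(α j j , β j j)` is nonzero is unknown, so `γ-#0` with i and j exchanged is
    -- split; either case gives a nonzero multiple of the claim.
    αβ-#0 : ∀ {i j} → i ≢ j → α i i * β j j - β i i * α j j # 0#
    αβ-#0 {i} {j} i≢j = [ via-α , via-β ]′ (+-#0 _ _ (γ-#0 (i≢j ∘ ≡.sym)))
      where
      Δ = α i i * β j j - β i i * α j j
      γ = t j * α i i - s j * β i i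
      via-α : t i * α j j # 0# → Δ # 0#
      via-α tα#0 = *-#0ʳ (s j) Δ (#-congʳ (begin
        α j j * (t j * α i i - s j * β i i)
          ≈⟨ solve 5 (λ aj tj ai sj bi → aj :* (tj :* ai :- sj :* bi) := ai :* (tj :* aj) :- sj :* (bi :* aj))
               refl _ _ _ _ _ ⟩
        α i i * (t j * α j j) - s j * (β i i * α j j)
          ≈⟨ +-congʳ (*-congˡ (tα≈sβ j j)) ⟩
        α i i * (s j * β j j) - s j * (β i i * α j j)
          ≈⟨ solve 5 (λ ai sj bj bi aj → ai :* (sj :* bj) :- sj :* (bi :* aj) := sj :* (ai :* bj :- bi :* aj))
               refl _ _ _ _ _ ⟩
        s j * Δ ∎)
        (x#0y#0→xy#0 (*-#0ʳ _ _ tα#0) (γ-#0 i≢j)))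
      via-β : - (s i * β j j) # 0# → Δ # 0#
      via-β -sβ#0 = *-#0ʳ (t j) Δ (#-congʳ (begin
        β j j * (t j * α i i - s j * β i i)
          ≈⟨ solve 5 (λ bj tj ai sj bi → bj :* (tj :* ai :- sj :* bi) := tj :* (ai :* bj) :- bi :* (sj :* bj))
               refl _ _ _ _ _ ⟩
        t j * (α i i * β j j) - β i i * (s j * β j j)
          ≈⟨ +-congˡ (-‿cong (*-congˡ (tα≈sβ j j))) ⟨
        t j * (α i i * β j j) - β i i * (t j * α j j)
          ≈⟨ solve 5 (λ tj ai bj bi aj → tj :* (ai :* bj) :- bi :* (tj :* aj) := tj :* (ai :* bj :- bi :* aj))
               refl _ _ _ _ _ ⟩
        t j * Δ ∎)
        (x#0y#0→xy#0
          (*-#0ʳ (- s i) (β j j) (#-congʳ (solve 2 (λ x y → :- (x :* y) := (:- x) :* y) refl _ _) -sβ#0))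
          (γ-#0 i≢j)))

    unique : (V : Mat n) → SimultaneouslyDiagonalizes V A B → SameColumns V U
    unique V ((W , WV≋1 , VW≋1) , VAV-diagonal , VBV-diagonal) =
      monomial⇒SameColumns V≋UC one-per-column
        -- `C` and `W · U` are mutually inverse, so every column and every row of `C` has an entry
        -- apart from zero.
        (λ k → let i , x#0 = inverse-support (W · U) C WUC≋1 k in i , *-#0ʳ ((W · U) k i) (C i k) x#0)
        (λ i → let k , x#0 = inverse-support C (W · U) CWU≋1 i in k , *-#0ˡ (C i k) ((W · U) k i) x#0)
      where
      open ChangeOfBasis {U = U} {Y} {V} {W} UY≋1 YU≋1 WV≋1 VW≋1

      column : (X : Mat n) → IsDiagonal (gram U X) → IsDiagonal (gram V X) →
               ∀ i k → gram U X i i * C i k ≈ E i k * gram V X k k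
      column X U-diag V-diag i k = trans (sym (diagonal-· U-diag C i k))
        (trans (intertwine X i k) (·-diagonal V-diag E i k))

      -- The vectors `C i k` · (α i i , β i i) and `C j k` · (α j j , β j j) are both multiples of
      -- `(a′ , b′)`, so their cross product vanishes, whereas `αβ-#0` says the two points differ.
      one-per-column : ∀ {i j k} → i ≢ j → C i k # 0# → C j k ≈ 0#
      one-per-column {i} {j} {k} i≢j Cik#0 = *-zero-cancelˡ (x#0y#0→xy#0 (αβ-#0 i≢j) Cik#0) (begin
        (α i i * β j j - β i i * α j j) * C i k * C j k
          ≈⟨ solve 6 (λ ai bj bi aj x y → (ai :* bj :- bi :* aj) :* x :* y :=
               (ai :* x) :* (bj :* y) :- (bi :* x) :* (aj :* y))
               refl (α i i) (β j j) (β i i) (α j j) (C i k) (C j k) ⟩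
        (α i i * C i k) * (β j j * C j k) - (β i i * C i k) * (α j j * C j k)
          ≈⟨ +-cong (*-cong (column-A i k) (column-B j k))
               (-‿cong (*-cong (column-B i k) (column-A j k))) ⟩
        (E i k * a′) * (E j k * b′) - (E i k * b′) * (E j k * a′)
          ≈⟨ solve 4 (λ x y a b → (x :* a) :* (y :* b) :- (x :* b) :* (y :* a) := x :- x)
               refl (E i k) (E j k) a′ b′ ⟩
        E i k - E i k
          ≈⟨ -‿inverseʳ _ ⟩
        0# ∎)
        where
        a′ = gram V A k k
        b′ = gram V B k k
        column-A = column A α-diagonal VAV-diagonal
        column-B = column B β-diagonal VBV-diagonal

  -- Rank-one adjugates at simple roots

  module SimpleRoots
    (A B : Mat n) (A-symmetric : IsSymmetric A) (B-symmetric : IsSymmetric B)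
    (s t : Vector Carrier n)
    (distinct : ∀ {i j} → i ≢ j → s i * t j - s j * t i # 0#)
    (factorization : ∀ x y →
      D.det (λ k l → ι (A k l) D.* x D.- ι (B k l) D.* y) D.≈
      D.product (λ k → ι (s k) D.* x D.- ι (t k) D.* y))
    (other : (i : Fin n) → ∃[ j ] i ≢ j)
    where

    M P : Fin n → Mat n
    M i = pencilAt A B (s i) (t i)
    P i = adjugate (M i)

    -- The factorization at (x , y) = (tᵢ + ε tⱼ , sᵢ + ε sⱼ), where Ax − By is
    -- Mᵢ + ε Mⱼ and only the i-th linear factor vanishes at ε = 0.
    private
      module _ {i j : Fin n} (i≢j : i ≢ j) where
        X : D.Mat n
        X k l = ι (A k l) D.* (t i , t j) D.- ι (B k l) D.* (s i , s j)

        factor : Vector D.Carrier n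
        factor k = ι (s k) D.* (t i , t j) D.- ι (t k) D.* (s i , s j)

        X₁≋M : mapMatrix proj₁ X ≋ M i
        X₁≋M k l = +-cong (*-comm _ _) (-‿cong (*-comm _ _))

        ε-part : ∀ x y z w x′ z′ → (x * y + 0# * x′) - (z * w + 0# * z′) ≈ x * y - z * w
        ε-part x y z w x′ z′ = +-cong (trans (+-congˡ (zeroˡ x′)) (+-identityʳ _))
          (-‿cong (trans (+-congˡ (zeroˡ z′)) (+-identityʳ _)))

        X₂≈M : ∀ k l → proj₂ (X k l) ≈ M j k l
        X₂≈M k l = trans (ε-part _ _ _ _ _ _) (+-cong (*-comm _ _) (-‿cong (*-comm _ _)))

        det-X : proj₁ (D.det X) ≈ 0# × proj₂ (D.det X) # 0#
        -- `distinct` enters twice: for the ε-part of factor i, and for the constant parts of all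
        -- other factors.
        det-X with product≈0 , product′#0 ← product-simple-zero factor i
                (trans (+-congˡ (-‿cong (*-comm (t i) (s i)))) (-‿inverseʳ _))
                (#-congʳ (sym (trans (ε-part _ _ _ _ _ _) (+-congˡ (-‿cong (*-comm (t i) (s j))))))
                  (distinct i≢j))
                (λ k k≢i → #-congʳ (+-congˡ (-‿cong (*-comm (s i) (t k)))) (distinct k≢i))
          with det≈ , det′≈ ← factorization (t i , t j) (s i , s j) =
          trans det≈ product≈0 , #-congʳ (sym det′≈) product′#0

        det-M′ : det (M i) ≈ 0#
        det-M′ = trans (sym (trans (det-proj₁ X) (det-cong X₁≋M))) (proj₁ det-X)

    trace-#0 : ∀ {i j} → i ≢ j → ∑ (λ k → ∑ (λ l → M j k l * P i l k)) # 0#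
    trace-#0 i≢j = #-congʳ
      (trans (det-proj₂ (X i≢j)) (∑-cong λ k → ∑-cong λ l →
        *-cong (X₂≈M i≢j k l) (adjugate-cong (X₁≋M i≢j) l k)))
      (proj₂ (det-X i≢j))

    det-M : ∀ i → det (M i) ≈ 0#
    det-M i = det-M′ (proj₂ (other i))

    M-symmetric : ∀ i → IsSymmetric (M i)
    M-symmetric i = pencilAt-cong (s i) (t i) A-symmetric B-symmetric

    P-symmetric : ∀ i → IsSymmetric (P i)
    P-symmetric i = adjugate-symmetric (M-symmetric i)

    P-rank-one : ∀ i {j k} → P i j k # 0# → ∀ p q r → P i p r * P i q k ≈ P i q r * P i p k
    P-rank-one i {j} {k} Pjk#0 p q r = x∙y⁻¹≈ε⇒x≈y _ _ (*-zero-cancelˡ Pjk#0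
      (trans (*-comm _ _) (adjugate-rank-one (M i) (det-M i) p q r k j)))

    -- The trace yields some entry `P i l k` apart from zero. By symmetry and rank one its square is
    -- `P i l l * P i k k`, so the diagonal entry at k is apart from zero too.
    pivot : ∀ i → ∃[ p ] P i p p # 0#
    pivot i =
      let j , i≢j = other i
          k , ∑#0 = ∑-#0 _ (trace-#0 i≢j)
          l , x#0 = ∑-#0 _ ∑#0
          Plk#0   = *-#0ʳ (M j k l) (P i l k) x#0
      in k , *-#0ʳ (P i l l) (P i k k) (#-congʳ (P-rank-one i Plk#0 k l l)
           (x#0y#0→xy#0 (#-congʳ (P-symmetric i l k) Plk#0) Plk#0))

    module _ (p : Fin n → Fin n) (P-pivot-#0 : ∀ i → P i (p i) (p i) # 0#) where
      U : Mat n
      U k i = P i k (p i)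

      c : Vector Carrier n
      c i = P i (p i) (p i)

      U-outer : ∀ i k l → U k i * U l i ≈ c i * P i k l
      U-outer i k l = begin
        P i k (p i) * P i l (p i)  ≈⟨ *-congˡ (P-symmetric i l (p i)) ⟩
        P i k (p i) * P i (p i) l  ≈⟨ trans (*-comm _ _) (sym (P-rank-one i (P-pivot-#0 i) k (p i) l)) ⟩
        P i k l * P i (p i) (p i)  ≈⟨ *-comm _ _ ⟩
        P i (p i) (p i) * P i k l  ∎

      M-kernel : ∀ i k → (M i · U) k i ≈ 0#
      M-kernel i k = trans (·-∑ (M i) U k i) (trans (sym (·-∑ (M i) (P i) k (p i))) M·P≈0)
        where
        M·P≈0 : (M i · P i) k (p i) ≈ 0#
        M·P≈0 with k Fin.≟ p i
        ... | yes k≡p = trans (reflexive (≡.cong (λ q → (M i · P i) q (p i)) k≡p))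
                          (trans (·-adjugate-diagonal (M i) (p i)) (det-M i))
        ... | no k≢p  = ·-adjugate-off (M i) k≢p

      M-nondegenerate : ∀ {i j} → i ≢ j → gram U (M j) i i # 0#
      M-nondegenerate {i} {j} i≢j = #-congʳ (begin
        c i * ∑ (λ k → ∑ (λ l → M j k l * P i l k))
          ≈⟨ trans (*-∑ˡ (c i) _) (∑-cong λ k → *-∑ˡ (c i) _) ⟩
        ∑ (λ k → ∑ (λ l → c i * (M j k l * P i l k)))
          ≈⟨ ∑-cong (λ k → ∑-cong λ l → begin
               c i * (M j k l * P i l k)  ≈⟨ solve 3 (λ x y z → x :* (y :* z) := y :* (x :* z)) refl _ _ _ ⟩
               M j k l * (c i * P i l k)  ≈⟨ *-congˡ (U-outer i l k) ⟨
               M j k l * (U l i * U k i)  ≈⟨ solve 3 (λ x y z → x :* (y :* z) := z :* (x :* y)) refl _ _ _ ⟩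
               U k i * (M j k l * U l i)  ∎) ⟩
        ∑ (λ k → ∑ (λ l → U k i * (M j k l * U l i)))
          ≈⟨ ∑-cong (λ k → trans (*-congˡ (·-∑ (M j) U k i)) (*-∑ˡ (U k i) _)) ⟨
        ∑ (λ k → U k i * (M j · U) k i)
          ≈⟨ ·-∑ (transpose U) (M j · U) i i ⟨
        (transpose U · (M j · U)) i i
          ≈⟨ ·-assoc (transpose U) (M j) U i i ⟨
        gram U (M j) i i ∎)
        (x#0y#0→xy#0 (P-pivot-#0 i) (trace-#0 i≢j))

      -- By `U-outer`, `P i` is the outer square of column i divided by the pivot, so the scalar is
      -- the inverse of the pivot.
      isSquare : ∀ i → IsSquareOf (P i) (transpose U i)
      isSquare i = d , inverse⇒#0 (trans (*-comm (c i) d) dc≈1) , λ x → begin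
        quadraticForm (P i) x
          ≈⟨ trans (sym (∑-sum _)) (∑-cong λ k → sym (∑-sum _)) ⟩
        ∑ (λ k → ∑ (λ l → x k * (P i k l * x l)))
          ≈⟨ ∑-cong (λ k → ∑-cong λ l → entry x k l) ⟩
        ∑ (λ k → ∑ (λ l → d * (U k i * x k * (U l i * x l))))
          ≈⟨ trans (*-∑ˡ d _) (∑-cong λ k → *-*-∑ d (U k i * x k) _) ⟨
        d * ∑ (λ k → U k i * x k * ∑ (λ l → U l i * x l))
          ≈⟨ *-congˡ (*-∑ʳ _ _) ⟨
        d * (∑ (λ k → U k i * x k) * ∑ (λ l → U l i * x l))
          ≈⟨ *-congˡ (*-cong (∑-sum _) (∑-sum _)) ⟩
        d * (linearForm (transpose U i) x * linearForm (transpose U i) x) ∎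
        where
        d : Carrier
        d = proj₁ (#0⇒inverse (P-pivot-#0 i))
        dc≈1 : d * c i ≈ 1#
        dc≈1 = proj₂ (#0⇒inverse (P-pivot-#0 i))
        entry : ∀ x k l → x k * (P i k l * x l) ≈ d * (U k i * x k * (U l i * x l))
        entry x k l = begin
          x k * (P i k l * x l)
            ≈⟨ trans (*-congʳ dc≈1) (*-identityˡ _) ⟨
          d * c i * (x k * (P i k l * x l))
            ≈⟨ solve 5 (λ d c x p y → d :* c :* (x :* (p :* y)) := d :* ((c :* p) :* (x :* y))) refl _ _ _ _ _ ⟩
          d * ((c i * P i k l) * (x k * x l))
            ≈⟨ *-congˡ (*-congʳ (U-outer i k l)) ⟨
          d * ((U k i * U l i) * (x k * x l))
            ≈⟨ solve 5 (λ d u v x y → d :* ((u :* v) :* (x :* y)) := d :* (u :* x :* (v :* y))) refl _ _ _ _ _ ⟩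
          d * (U k i * x k * (U l i * x l)) ∎

      simultaneous-diagonalization : Σ[ U ∈ Mat n ]
        SimultaneouslyDiagonalizes U A B ×
        (∀ V → SimultaneouslyDiagonalizes V A B → SameColumns V U) ×
        (∀ i → IsSquareOf (P i) (transpose U i))
      simultaneous-diagonalization = U , E.diagonalizes , E.unique , isSquare
        where module E = Eigenvectors A B A-symmetric B-symmetric s t distinct other U
                           M-kernel M-nondegenerate

-- From the polynomial factorization to the theorem

-- A second root supplies the direction of ε at root i and a form `M j` that does not vanish on
-- column i of `U`.
another : n ℕ.≥ 2 → (i : Fin n) → ∃[ j ] i ≢ j
another (s≤s (s≤s _)) zero    = suc zero , λ ()
another (s≤s (s≤s _)) (suc i) = zero , λ ()

module _ {K : HeytingField a₁ ℓ₁ r₁} {L : HeytingField a₂ ℓ₂ r₂}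
  {κ : HeytingField.Carrier K → HeytingField.Carrier L}
  {A B : Matrix (HeytingField.Carrier K) n} {s t : Vector (HeytingField.Carrier L) n}
  (splitting : IsSplittingField K L κ (BinaryForms.pencilForm (fieldRing K) A B) s t)
  where
  private
    open IsSplittingField splitting
    open DualNumbers (Field.R L) using (dualNumbers; ι; ι-isRingHomomorphism)
    open CommutativeRing dualNumbers
    open MatrixOps rawRing using (det)
    open Algebra.Definitions.RawSemiring (RawRing.rawSemiring rawRing) using (product)
    open Algebra.Definitions.RawSemiring (RawRing.rawSemiring (polynomialRing₂ (fieldRing L)))
      using () renaming (product to product[x,y])

    ικ-isRingHomomorphism : RingMorphisms.IsRingHomomorphism (fieldRing K) rawRing (ι ∘ κ)
    ικ-isRingHomomorphism =
      Composition.isRingHomomorphism trans isRingHomomorphism ι-isRingHomomorphism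

    module _ (x y : Carrier) where
      module EvalK = BinaryEvaluation (fieldRing K) dualNumbers (ι ∘ κ) x y
      module EvalL = BinaryEvaluation (fieldRing L) dualNumbers ι x y

      evalˣ-map : ∀ p → EvalL.evalˣ (List.map κ p) ≡ EvalK.evalˣ p
      evalˣ-map []      = ≡.refl
      evalˣ-map (c ∷ p) = ≡.cong (λ v → ι (κ c) + x * v) (evalˣ-map p)

      eval₂-map : ∀ p → EvalL.eval₂ (mapPoly₂ κ p) ≡ EvalK.eval₂ p
      eval₂-map []      = ≡.refl
      eval₂-map (q ∷ p) = ≡.cong₂ (λ u v → u + y * v) (evalˣ-map q) (eval₂-map p)

  -- Equality of all coefficients survives evaluation at points of any commutative ring over `L`, so
  -- the formal factorization may be read over the dual numbers, where it also records derivatives.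
  dual-factorization : ∀ x y →
    det (λ k l → ι (mapMatrix κ A k l) * x - ι (mapMatrix κ B k l) * y) ≈
    product (λ k → ι (s k) * x - ι (t k) * y)
  dual-factorization x y = begin
    det (λ k l → ι (κ (A k l)) * x - ι (κ (B k l)) * y)
      ≈⟨ EvalK.eval₂-pencilForm x y ικ-isRingHomomorphism A B ⟨
    EvalK.eval₂ x y F
      ≡⟨ eval₂-map x y F ⟨
    EvalL.eval₂ x y (mapPoly₂ κ F)
      ≈⟨ EvalL.eval₂-cong x y ι-isRingHomomorphism (mapPoly₂ κ F) G factorization ⟩
    EvalL.eval₂ x y G
      ≈⟨ EvalL.eval₂-product x y ι-isRingHomomorphism s t ⟩
    product (λ k → ι (s k) * x - ι (t k) * y) ∎
    where
    open Relation.Binary.Reasoning.Setoid setoid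
    F = BinaryForms.pencilForm (fieldRing K) A B
    G = product[x,y] (λ j → BinaryForms.binaryLinear (fieldRing L) (s j) (t j))

theorem1p5 :
    {a₁ ℓ₁ r₁ a₂ ℓ₂ r₂ : Level}
    (K : HeytingField a₁ ℓ₁ r₁) → CharacteristicZero K →
    (n : ℕ) → n ≥ 3 →
    (A B : Matrix (HeytingField.Carrier K) n) →
    MatrixOps.IsSymmetric (fieldRing K) A →
    MatrixOps.IsSymmetric (fieldRing K) B →
    (L : HeytingField a₂ ℓ₂ r₂) →
    (ι : HeytingField.Carrier K → HeytingField.Carrier L) →
    (s t : Vector (HeytingField.Carrier L) n) →
    IsSplittingField K L ι (BinaryForms.pencilForm (fieldRing K) A B) s t →
    HeytingField._#_ L (discriminant (fieldRing L) s t) (HeytingField.0# L) →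
    let open Diagonalization L
        Aᴸ = mapMatrix ι A
        Bᴸ = mapMatrix ι B
    in
    Σ[ U ∈ Mat n ]
      SimultaneouslyDiagonalizes U Aᴸ Bᴸ ×
      (∀ V → SimultaneouslyDiagonalizes V Aᴸ Bᴸ → SameColumns V U) ×
      (∀ i → IsSquareOf (adjugate (pencilAt Aᴸ Bᴸ (s i) (t i))) (transpose U i))
theorem1p5 K _ n n≥3 A B A-symmetric B-symmetric L ι s t splitting disc#0 =
  simultaneous-diagonalization (proj₁ ∘ pivot) (proj₂ ∘ pivot)
  where
  open RingMorphisms.IsRingHomomorphism (IsSplittingField.isRingHomomorphism splitting)
    using (⟦⟧-cong)
  open Pencils L
  open SimpleRoots (mapMatrix ι A) (mapMatrix ι B)
    (λ i j → ⟦⟧-cong (A-symmetric i j)) (λ i j → ⟦⟧-cong (B-symmetric i j))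
    s t (discriminant-#0 disc#0) (dual-factorization {A = A} {B} splitting)
    (another (ℕ.≤-trans (ℕ.n≤1+n 2) n≥3))
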